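{- Let $\mathcal{F}=(\mathcal{F}_1,\ldots,\mathcal{F}_n,\ldots)$ be a sequence of increasing families with $\mathcal{F}_n\subseteq\mathcal{M}_n$ for each $n$. Define $t=t(n)=\min\{r\mid P_r(\mathcal{F}_n(r))\ge 1/2\}$. Then $t$ is a threshold for $\mathcal{F}$, i.e. for every function $\omega=\omega(n)\to\infty$ we have $P_{t\omega}(\mathcal{F}_n(t\omega))\to 1$ and $P_{t/\omega}(\mathcal{F}_n(t/\omega))\to 0$ as $n\to\infty$.
   Context: $\mathcal{M}_n$ is the poset of all (finite) multisets of $[n]=\{1,\ldots,n\}$ ordered by inclusion; $\mathcal{M}_n(r)$ is the set of $r$-element multisets, of cardinality $\binom{n+r-1}{r}$. For $\mathcal{F}_n\subseteq\mathcal{M}_n$, $\mathcal{F}_n(r)=\mathcal{F}_n\cap\mathcal{M}_n(r)$, and $P_r(\mathcal{F}_n(r))=|\mathcal{F}_n(r)|/\binom{n+r-1}{r}$ is the probability that a uniformly random $r$-multiset of $[n]$ lies in $\mathcal{F}_n$. A family $\mathcal{F}_n$ is increasing if $E\supseteq F\in\mathcal{F}_n$ implies $E\in\mathcal{F}_n$. Non-integer values $t\omega$, $t/\omega$ are interpreted as the nearest integer.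
   Formalization: Adds the hypothesis that F_n ≠ M_n for all large n; if F_n = M_n infinitely often then t = 0 and P_{t/ω} = 1 there, so the claim fails. ω takes positive rational values, which yields every real ω since only rounded values matter; membership in F_n is taken decidable. -}

module Defs where

open import Data.Nat using (ℕ; zero; suc; _+_; _*_; _∸_; _≤_; _<_; _/_)
open import Data.Bool using (Bool; true; false)
open import Data.Vec using (Vec; []; _∷_; lookup; replicate)
open import Data.Fin using (Fin)
open import Data.List using (List; []; _∷_; [_]; map; concatMap; upTo; length; filterᵇ)
open import Data.Product using (Σ; ∃; _×_)
open import Relation.Binary.PropositionalEquality using (_≡_)

-- A multiset of [n] = {1..n} is its multiplicity vector (entry i = multiplicity of i+1).
Multiset : ℕ → Set
Multiset n = Vec ℕ n

_⊑_ : {n : ℕ} → Multiset n → Multiset n → Set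
_⊑_ {n} F E = (i : Fin n) → lookup F i ≤ lookup E i

-- Enumeration of M_n(r): all multisets of [n] of cardinality r (each exactly once).
Mr : (n r : ℕ) → List (Multiset n)
Mr zero zero = [ [] ]
Mr zero (suc r) = []
Mr (suc n) r = concatMap (λ k → map (k ∷_) (Mr n (r ∸ k))) (upTo (suc r))

Family : Set
Family = (n : ℕ) → Multiset n → Bool

Increasing : Family → Set
Increasing F = (n : ℕ) (G E : Multiset n) → G ⊑ E → F n G ≡ true → F n E ≡ true

total : (n r : ℕ) → ℕ
total n r = length (Mr n r)

count : Family → (n r : ℕ) → ℕ
count F n r = length (filterᵇ (F n) (Mr n r))

-- P_r(F_n(r)) = count / total; comparisons are written by cross-multiplication.
-- P_r(F_n(r)) ≥ 1/2
HalfOrMore : Family → (n r : ℕ) → Set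
HalfOrMore F n r = total n r ≤ 2 * count F n r

-- Nearest integer to x / (d+1), rounding halves up: ⌊(2x + d + 1) / (2(d+1))⌋.
roundDiv : (x d : ℕ) → ℕ
roundDiv x d = (2 * x + suc d) / suc (d + suc d)

-- A positive rational sequence ω(n) = suc (p n) / suc (q n) tends to infinity.
TendsToInfinity : (p q : ℕ → ℕ) → Set
TendsToInfinity p q = (M : ℕ) → ∃ λ N → (n : ℕ) → N ≤ n → M * suc (q n) ≤ suc (p n)

tTimesω : (t p q : ℕ → ℕ) → ℕ → ℕ
tTimesω t p q n = roundDiv (t n * suc (p n)) (q n)

tOverω : (t p q : ℕ → ℕ) → ℕ → ℕ
tOverω t p q n = roundDiv (t n * suc (q n)) (p n)

-- P_{s n}(F_n(s n)) → 1 as n → ∞ :  for every k, eventually k·(1 - P) ≤ 1.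
ProbTo1 : Family → (ℕ → ℕ) → Set
ProbTo1 F s = (k : ℕ) → ∃ λ N → (n : ℕ) → N ≤ n →
  k * (total n (s n) ∸ count F n (s n)) ≤ total n (s n)

-- P_{s n}(F_n(s n)) → 0 as n → ∞ :  for every k, eventually k·P ≤ 1.
ProbTo0 : Family → (ℕ → ℕ) → Set
ProbTo0 F s = (k : ℕ) → ∃ λ N → (n : ℕ) → N ≤ n →
  k * count F n (s n) ≤ total n (s n)

IsThresholdMin : Family → (ℕ → ℕ) → Set
IsThresholdMin F t = (n : ℕ) → 1 ≤ n →
  HalfOrMore F n (t n) × ((r : ℕ) → r < t n → total n r > 2 * count F n r)
  where open import Data.Nat using (_>_)

{-# OPTIONS --safe #-}
module Submission where

-- Write P_r for the density of F at level r and Q_r = 1 - P_r. It suffices to find constants such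
-- that P_r is small as soon as P_{Cr} ≤ 1/2, and Q_{Cr} is small as soon as P_r ≥ 1/2; this is done
-- by iterating a contraction, for which there are two reasons depending on the size of r.
-- If 2r ≤ n, use the Markov chain on multisets that removes a random element and adds one by the
-- Pólya rule. Its raising and lowering operators satisfy D U - U D = 2r + n, which gives its spectral
-- gap by induction on r, and for increasing F the gap inequality becomes
-- P_{r+1} - P_r ≥ n P_{r+1} Q_{r+1} / ((r + 1)(n + r)). Summing from r to 2r gives the contraction.
-- If 2r > n, let Y and X be independent uniform s-multisets with s ≥ C r. Given its size, Y ∧ X is
-- uniform, and with probability close to 1 at least half of the multiplicities of Y ∧ X are
-- at least 2r/n, whence |Y ∧ X| ≥ r. If Y ∧ X lies in F then so do Y and X, so P_s² ≥ (1 - δ) P_r.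

open import Defs
open import Data.Nat
open import Data.Nat.DivMod
open import Data.Nat.Properties
open import Data.Nat.Tactic.RingSolver using (solve-∀)
open import Data.Bool using (Bool; true; false)
open import Data.Fin using (zero; suc)
open import Data.List as List using (List)
import Data.List.Properties as Listₚ
open import Data.Product using (∃; _×_; _,_; proj₁; proj₂)
open import Data.Sum using (_⊎_; inj₁; inj₂)
open import Data.Vec as Vec using ([]; _∷_; zipWith; tail)
open import Function using (_∘_)
open import Relation.Binary.PropositionalEquality

-- Neither argument covers all r. By the gap inequality the relative gain from r to 2r is of order n
-- / (n + r), a constant only while r is at most a multiple of n. Conversely, for s small against n
-- the meet of two s-multisets is far smaller than s. A sum of independent uniform multisets is not
-- uniform in general, which rules out the usual passage to multiples of r by independent copies;
-- the meet avoids this. The contraction in the first case is 8/9. The meet gives about Q_s ≤ 2/3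
-- (Q_r + δ), whose error δ must shrink together with Q. Both are therefore brought to one form: a
-- bound 8 / (8 + k) becomes 8 / (9 + k), with δ = 1 / (8 + k) at stage k, starting from the trivial
-- bound 1. Densities are never formed: inequalities are cross-multiplied over the natural numbers,
-- and complementary counts w with c + w = T take the place of subtraction.

-- Sums over the r-multisets of [n]

size : ∀ {n} → Multiset n → ℕ
size = Vec.sum

bump : ∀ {n} → Multiset (suc n) → Multiset (suc n)
bump (k ∷ E) = suc k ∷ E

-- The recursion is Pascal's rule: either the first element is absent, or one copy of it can be
-- removed. Unlike the enumeration `Mr`, it has no inner range over the first multiplicity.
∑ : (n r : ℕ) → (Multiset n → ℕ) → ℕ
∑ zero    zero    f = f []
∑ zero    (suc r) f = 0
∑ (suc n) zero    f = ∑ n zero (f ∘ (0 ∷_))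
∑ (suc n) (suc r) f = ∑ n (suc r) (f ∘ (0 ∷_)) + ∑ (suc n) r (f ∘ bump)

∑-mono-size : ∀ n r {f g} → (∀ E → size E ≡ r → f E ≤ g E) → ∑ n r f ≤ ∑ n r g
∑-mono-size zero    zero    h = h [] refl
∑-mono-size zero    (suc r) h = z≤n
∑-mono-size (suc n) zero    h = ∑-mono-size n zero λ E → h (0 ∷ E)
∑-mono-size (suc n) (suc r) h = +-mono-≤
  (∑-mono-size n (suc r) λ E → h (0 ∷ E))
  (∑-mono-size (suc n) r λ { (k ∷ E) e → h (suc k ∷ E) (cong suc e) })

∑-cong-size : ∀ n r {f g} → (∀ E → size E ≡ r → f E ≡ g E) → ∑ n r f ≡ ∑ n r g
∑-cong-size n r h = ≤-antisym
  (∑-mono-size n r λ E e → ≤-reflexive (h E e))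
  (∑-mono-size n r λ E e → ≤-reflexive (sym (h E e)))

∑-mono : ∀ n r {f g} → (∀ E → f E ≤ g E) → ∑ n r f ≤ ∑ n r g
∑-mono n r h = ∑-mono-size n r λ E _ → h E

∑-cong : ∀ n r {f g} → (∀ E → f E ≡ g E) → ∑ n r f ≡ ∑ n r g
∑-cong n r h = ∑-cong-size n r λ E _ → h E

∑-+ : ∀ n r f g → ∑ n r (λ E → f E + g E) ≡ ∑ n r f + ∑ n r g
∑-+ zero    zero    f g = refl
∑-+ zero    (suc r) f g = refl
∑-+ (suc n) zero    f g = ∑-+ n zero _ _
∑-+ (suc n) (suc r) f g = trans
  (cong₂ _+_ (∑-+ n (suc r) _ _) (∑-+ (suc n) r (f ∘ bump) (g ∘ bump)))
  (+-interchange (∑ n (suc r) (f ∘ (0 ∷_))) _ _ _)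
  where
  +-interchange : ∀ a b c d → (a + b) + (c + d) ≡ (a + c) + (b + d)
  +-interchange = solve-∀

∑-* : ∀ n r c f → ∑ n r (λ E → c * f E) ≡ c * ∑ n r f
∑-* zero    zero    c f = refl
∑-* zero    (suc r) c f = sym (*-zeroʳ c)
∑-* (suc n) zero    c f = ∑-* n zero c _
∑-* (suc n) (suc r) c f = trans
  (cong₂ _+_ (∑-* n (suc r) c _) (∑-* (suc n) r c (f ∘ bump)))
  (sym (*-distribˡ-+ c (∑ n (suc r) (f ∘ (0 ∷_))) _))

∑-*ʳ : ∀ n r c f → ∑ n r (λ E → f E * c) ≡ ∑ n r f * c
∑-*ʳ n r c f = begin
  ∑ n r (λ E → f E * c) ≡⟨ ∑-cong n r (λ E → *-comm (f E) c) ⟩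
  ∑ n r (λ E → c * f E) ≡⟨ ∑-* n r c f ⟩
  c * ∑ n r f           ≡⟨ *-comm c _ ⟩
  ∑ n r f * c           ∎
  where open ≡-Reasoning

# : ℕ → ℕ → ℕ
# n r = ∑ n r (λ _ → 1)

∑-const : ∀ n r c → ∑ n r (λ _ → c) ≡ # n r * c
∑-const n r c = trans (∑-cong n r λ _ → sym (*-identityˡ c)) (∑-*ʳ n r c _)

#-pos : ∀ n r → 1 ≤ # (suc n) r
#-pos zero    zero    = ≤-refl
#-pos (suc n) zero    = #-pos n zero
#-pos n       (suc r) = ≤-trans (#-pos n r) (m≤n+m _ _)

-- Comparison with the enumeration Mr

listSum : ∀ {A : Set} → (A → ℕ) → List A → ℕ
listSum f List.[]       = 0
listSum f (x List.∷ xs) = f x + listSum f xs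

listSum-++ : ∀ {A : Set} (f : A → ℕ) xs ys →
             listSum f (xs List.++ ys) ≡ listSum f xs + listSum f ys
listSum-++ f List.[]       ys = refl
listSum-++ f (x List.∷ xs) ys = trans (cong (f x +_) (listSum-++ f xs ys)) (sym (+-assoc (f x) _ _))

listSum-map : ∀ {A B : Set} (f : B → ℕ) (g : A → B) xs →
              listSum f (List.map g xs) ≡ listSum (f ∘ g) xs
listSum-map f g List.[]       = refl
listSum-map f g (x List.∷ xs) = cong (f (g x) +_) (listSum-map f g xs)

-- The slices with positive first multiplicity at level r + 1 are the bumped slices of level r. This
-- is the recursion that defines `∑`.
Mr-suc : ∀ n r → Mr (suc n) (suc r) ≡
         List.map (0 ∷_) (Mr n (suc r)) List.++ List.map bump (Mr (suc n) r)
Mr-suc n r = cong (List.map (0 ∷_) (Mr n (suc r)) List.++_) (begin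
  List.concatMap (slice (suc r)) (List.applyUpTo suc (suc r))
    ≡⟨ cong (List.concatMap (slice (suc r))) (Listₚ.map-upTo suc (suc r)) ⟨
  List.concatMap (slice (suc r)) (List.map suc (List.upTo (suc r)))
    ≡⟨ Listₚ.concatMap-map (slice (suc r)) suc (List.upTo (suc r)) ⟩
  List.concatMap (slice (suc r) ∘ suc) (List.upTo (suc r))
    ≡⟨ Listₚ.concatMap-cong (λ k → Listₚ.map-∘ (Mr n (r ∸ k))) (List.upTo (suc r)) ⟩
  List.concatMap (List.map bump ∘ slice r) (List.upTo (suc r))
    ≡⟨ Listₚ.map-concatMap bump (slice r) (List.upTo (suc r)) ⟨
  List.map bump (Mr (suc n) r) ∎)
  where
  open ≡-Reasoning
  slice : ℕ → ℕ → List (Multiset (suc n))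
  slice s k = List.map (k ∷_) (Mr n (s ∸ k))

listSum-Mr : ∀ n r f → listSum f (Mr n r) ≡ ∑ n r f
listSum-Mr zero    zero    f = +-identityʳ _
listSum-Mr zero    (suc r) f = refl
listSum-Mr (suc n) zero    f = begin
  listSum f (List.map (0 ∷_) (Mr n zero) List.++ List.[])
    ≡⟨ cong (listSum f) (Listₚ.++-identityʳ (List.map (0 ∷_) (Mr n zero))) ⟩
  listSum f (List.map (0 ∷_) (Mr n zero)) ≡⟨ listSum-map f _ (Mr n zero) ⟩
  listSum (f ∘ (0 ∷_)) (Mr n zero)        ≡⟨ listSum-Mr n zero _ ⟩
  ∑ n zero (f ∘ (0 ∷_))                   ∎
  where open ≡-Reasoning
listSum-Mr (suc n) (suc r) f = begin
  listSum f (Mr (suc n) (suc r))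
    ≡⟨ cong (listSum f) (Mr-suc n r) ⟩
  listSum f (List.map (0 ∷_) (Mr n (suc r)) List.++ List.map bump (Mr (suc n) r))
    ≡⟨ listSum-++ f (List.map (0 ∷_) (Mr n (suc r))) _ ⟩
  listSum f (List.map (0 ∷_) (Mr n (suc r))) + listSum f (List.map bump (Mr (suc n) r))
    ≡⟨ cong₂ _+_ (listSum-map f _ (Mr n (suc r))) (listSum-map f bump (Mr (suc n) r)) ⟩
  listSum (f ∘ (0 ∷_)) (Mr n (suc r)) + listSum (f ∘ bump) (Mr (suc n) r)
    ≡⟨ cong₂ _+_ (listSum-Mr n (suc r) _) (listSum-Mr (suc n) r _) ⟩
  ∑ (suc n) (suc r) f ∎
  where open ≡-Reasoning

indicator : Bool → ℕ
indicator true  = 1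
indicator false = 0

length-filterᵇ : ∀ {A : Set} (p : A → Bool) xs →
                 List.length (List.filterᵇ p xs) ≡ listSum (indicator ∘ p) xs
length-filterᵇ p List.[] = refl
length-filterᵇ p (x List.∷ xs) with p x
... | true  = cong suc (length-filterᵇ p xs)
... | false = length-filterᵇ p xs

length-listSum : ∀ {A : Set} (xs : List A) → List.length xs ≡ listSum (λ _ → 1) xs
length-listSum List.[]       = refl
length-listSum (x List.∷ xs) = cong suc (length-listSum xs)

total≡# : ∀ n r → total n r ≡ # n r
total≡# n r = trans (length-listSum (Mr n r)) (listSum-Mr n r _)

count≡∑ : ∀ F n r → count F n r ≡ ∑ n r (indicator ∘ F n)
count≡∑ F n r = trans (length-filterᵇ (F n) (Mr n r)) (listSum-Mr n r _)

-- Raising and lowering operators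

-- Weighting the addition of an element by its multiplicity plus one is the Pólya rule, up to the
-- normalisation `size E + n`. A function on level r + 1 becomes a function on level r.
D : ∀ {n} → (Multiset n → ℕ) → Multiset n → ℕ
D f []      = 0
D f (k ∷ E) = suc k * f (suc k ∷ E) + D (f ∘ (k ∷_)) E

-- The adjoint of `D`: removal of an element chosen by multiplicity. The value at `pred 0` is
-- harmless, because its coefficient is 0.
U : ∀ {n} → (Multiset n → ℕ) → Multiset n → ℕ
U f []      = 0
U f (k ∷ E) = k * f (pred k ∷ E) + U (f ∘ (k ∷_)) E

D-linear : ∀ {n} c (f g : Multiset n → ℕ) E →
           D (λ X → c * f X + g X) E ≡ c * D f E + D g E
D-linear c f g []      = sym (trans (+-identityʳ _) (*-zeroʳ c))
D-linear c f g (k ∷ E) = trans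
  (cong (suc k * (c * f (suc k ∷ E) + g (suc k ∷ E)) +_)
        (D-linear c (f ∘ (k ∷_)) (g ∘ (k ∷_)) E))
  (rearrange (suc k) c (f (suc k ∷ E)) (g (suc k ∷ E)) (D (f ∘ (k ∷_)) E) (D (g ∘ (k ∷_)) E))
  where
  rearrange : ∀ l c x y u v → l * (c * x + y) + (c * u + v) ≡ c * (l * x + u) + (l * y + v)
  rearrange = solve-∀

U-linear : ∀ {n} c (f g : Multiset n → ℕ) E →
           U (λ X → c * f X + g X) E ≡ c * U f E + U g E
U-linear c f g []      = sym (trans (+-identityʳ _) (*-zeroʳ c))
U-linear c f g (k ∷ E) = trans
  (cong (k * (c * f (pred k ∷ E) + g (pred k ∷ E)) +_)
        (U-linear c (f ∘ (k ∷_)) (g ∘ (k ∷_)) E))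
  (rearrange k c (f (pred k ∷ E)) (g (pred k ∷ E)) (U (f ∘ (k ∷_)) E) (U (g ∘ (k ∷_)) E))
  where
  rearrange : ∀ l c x y u v → l * (c * x + y) + (c * u + v) ≡ c * (l * x + u) + (l * y + v)
  rearrange = solve-∀

U-size0 : ∀ {n} (f : Multiset n → ℕ) E → size E ≡ 0 → U f E ≡ 0
U-size0 f []         e = refl
U-size0 f (zero ∷ E) e = U-size0 (f ∘ (0 ∷_)) E e

D-one : ∀ {n} (E : Multiset n) → D (λ _ → 1) E ≡ size E + n
D-one []      = refl
D-one {suc n} (k ∷ E) = trans (cong (suc k * 1 +_) (D-one E)) (rearrange k (size E) n)
  where
  rearrange : ∀ k s n → suc k * 1 + (s + n) ≡ k + s + suc n
  rearrange = solve-∀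

U-one : ∀ {n} (E : Multiset n) → U (λ _ → 1) E ≡ size E
U-one []      = refl
U-one (k ∷ E) = cong₂ _+_ (*-identityʳ k) (U-one E)

-- Both sides sum f(E) g(E + i) over all E of size r and all elements i, with the multiplicity of i
-- in E + i as weight. The first coordinate is separated from the others because the recursion of
-- `∑` touches only that one.
adjoint : ∀ n r (f g : Multiset n → ℕ) →
          ∑ n (suc r) (λ E → U f E * g E) ≡ ∑ n r (λ E → f E * D g E)
adjoint zero    zero    f g = sym (*-zeroʳ (f []))
adjoint zero    (suc r) f g = refl
adjoint (suc n) r       f g = begin
  ∑ (suc n) (suc r) (λ E → U f E * g E)
    ≡⟨ ∑-cong (suc n) (suc r) U-split ⟩
  ∑ (suc n) (suc r) (λ E → head-U f E * g E + tail-U f E * g E)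
    ≡⟨ ∑-+ (suc n) (suc r) (λ E → head-U f E * g E) (λ E → tail-U f E * g E) ⟩
  ∑ (suc n) (suc r) (λ E → head-U f E * g E) + ∑ (suc n) (suc r) (λ E → tail-U f E * g E)
    ≡⟨ cong₂ _+_ (head-adjoint r) (tail-adjoint r f g) ⟩
  ∑ (suc n) r (λ E → f E * head-D g E) + ∑ (suc n) r (λ E → f E * tail-D g E)
    ≡⟨ ∑-+ (suc n) r (λ E → f E * head-D g E) (λ E → f E * tail-D g E) ⟨
  ∑ (suc n) r (λ E → f E * head-D g E + f E * tail-D g E)
    ≡⟨ ∑-cong (suc n) r D-split ⟨
  ∑ (suc n) r (λ E → f E * D g E) ∎
  where
  open ≡-Reasoning
  head-U tail-U head-D tail-D : (Multiset (suc n) → ℕ) → Multiset (suc n) → ℕ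
  head-U f (k ∷ E) = k * f (pred k ∷ E)
  tail-U f (k ∷ E) = U (f ∘ (k ∷_)) E
  head-D g (k ∷ E) = suc k * g (suc k ∷ E)
  tail-D g (k ∷ E) = D (g ∘ (k ∷_)) E

  U-split : ∀ E → U f E * g E ≡ head-U f E * g E + tail-U f E * g E
  U-split (k ∷ E) = *-distribʳ-+ (g (k ∷ E)) (k * f (pred k ∷ E)) (U (f ∘ (k ∷_)) E)

  D-split : ∀ E → f E * D g E ≡ f E * head-D g E + f E * tail-D g E
  D-split (k ∷ E) = *-distribˡ-+ (f (k ∷ E)) (suc k * g (suc k ∷ E)) (D (g ∘ (k ∷_)) E)

  tail-U-bump : ∀ f g E → tail-U f (bump E) * g (bump E) ≡ tail-U (f ∘ bump) E * (g ∘ bump) E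
  tail-U-bump f g (k ∷ E) = refl

  tail-D-bump : ∀ f g E → (f ∘ bump) E * tail-D (g ∘ bump) E ≡ f (bump E) * tail-D g (bump E)
  tail-D-bump f g (k ∷ E) = refl

  rearrange : ∀ k a b → k * a * b ≡ a * (k * b)
  rearrange = solve-∀

  head-adjoint : ∀ r → ∑ (suc n) (suc r) (λ E → head-U f E * g E) ≡ ∑ (suc n) r (λ E → f E * head-D g E)
  head-adjoint r = cong₂ _+_
    (trans (∑-const n (suc r) 0) (*-zeroʳ (# n (suc r))))
    (∑-cong (suc n) r λ { (k ∷ E) → rearrange (suc k) (f (k ∷ E)) (g (suc k ∷ E)) })

  tail-adjoint : ∀ r f g → ∑ (suc n) (suc r) (λ E → tail-U f E * g E) ≡ ∑ (suc n) r (λ E → f E * tail-D g E)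
  tail-adjoint zero f g = trans
    (cong₂ _+_
      (adjoint n zero (f ∘ (0 ∷_)) (g ∘ (0 ∷_)))
      (trans
        -- A singleton consisting of the first element has an empty tail, from which nothing can be
        -- removed.
        (∑-cong-size n 0 λ E e → cong (_* g (1 ∷ E)) (U-size0 (f ∘ (1 ∷_)) E e))
        (trans (∑-const n 0 0) (*-zeroʳ (# n 0)))))
    (+-identityʳ _)
  tail-adjoint (suc r) f g = cong₂ _+_
    (adjoint n (suc r) (f ∘ (0 ∷_)) (g ∘ (0 ∷_)))
    (trans
      (∑-cong (suc n) (suc r) (tail-U-bump f g))
      (trans (tail-adjoint r (f ∘ bump) (g ∘ bump)) (∑-cong (suc n) r (tail-D-bump f g))))

-- Adding i and removing j ≠ i commute, with the same weights. For j = i the weights are (k + 1)² in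
-- one order and k² in the other, and the differences 2k + 1 sum to 2 size E + n.
commutator : ∀ {n} (f : Multiset n → ℕ) E → D (U f) E ≡ U (D f) E + (2 * size E + n) * f E
commutator f [] = refl
commutator {suc n} f (k ∷ E) = begin
  suc k * (suc k * f (k ∷ E) + U f₊ E) + D (λ X → k * f (pred k ∷ X) + U (f ∘ (k ∷_)) X) E
    ≡⟨ cong (suc k * (suc k * f (k ∷ E) + U f₊ E) +_) (trans
         (D-linear k f₋ (U f₀) E) (cong (k * D f₋ E +_) (commutator f₀ E))) ⟩
  suc k * (suc k * f (k ∷ E) + U f₊ E) + (k * D f₋ E + (U (D f₀) E + (2 * size E + n) * f (k ∷ E)))
    ≡⟨ rearrange k ⟩
  k * (suc (pred k) * f (suc (pred k) ∷ E) + D f₋ E) + (suc k * U f₊ E + U (D f₀) E)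
    + (2 * (k + size E) + suc n) * f (k ∷ E)
    ≡⟨ cong (λ z → k * D f (pred k ∷ E) + z + (2 * (k + size E) + suc n) * f (k ∷ E))
            (U-linear (suc k) f₊ (D f₀) E) ⟨
  U (D f) (k ∷ E) + (2 * size (k ∷ E) + suc n) * f (k ∷ E) ∎
  where
  open ≡-Reasoning
  f₊ f₀ f₋ : Multiset n → ℕ
  f₊ = f ∘ (suc k ∷_)
  f₀ = f ∘ (k ∷_)
  f₋ = f ∘ (pred k ∷_)

  case-zero : ∀ x u d v s n → 1 * (1 * x + u) + (0 * d + (v + (2 * s + n) * x)) ≡
              1 * u + v + (2 * s + suc n) * x
  case-zero = solve-∀

  case-suc : ∀ k x u d v s n →
    suc (suc k) * (suc (suc k) * x + u) + (suc k * d + (v + (2 * s + n) * x)) ≡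
    suc k * (suc k * x + d) + (suc (suc k) * u + v) + (2 * (suc k + s) + suc n) * x
  case-suc = solve-∀

  -- For l = 0, `suc (pred l)` differs from l, but the term that contains it has coefficient l.
  rearrange : ∀ l {u d v s} →
    suc l * (suc l * f (l ∷ E) + u) + (l * d + (v + (2 * s + n) * f (l ∷ E))) ≡
    l * (suc (pred l) * f (suc (pred l) ∷ E) + d) + (suc l * u + v) + (2 * (l + s) + suc n) * f (l ∷ E)
  rearrange zero    {u} {d} {v} {s} = case-zero (f (0 ∷ E)) u d v s n
  rearrange (suc l) {u} {d} {v} {s} = case-suc l (f (suc l ∷ E)) u d v s n

∑-D : ∀ n r f → ∑ n r (D f) ≡ suc r * ∑ n (suc r) f
∑-D n r f = begin
  ∑ n r (D f)                              ≡⟨ ∑-cong n r (λ E → *-identityˡ (D f E)) ⟨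
  ∑ n r (λ E → 1 * D f E)                  ≡⟨ adjoint n r (λ _ → 1) f ⟨
  ∑ n (suc r) (λ E → U (λ _ → 1) E * f E)  ≡⟨ ∑-cong-size n (suc r) (λ E e → cong (_* f E) (trans (U-one E) e)) ⟩
  ∑ n (suc r) (λ E → suc r * f E)          ≡⟨ ∑-* n (suc r) (suc r) f ⟩
  suc r * ∑ n (suc r) f                    ∎
  where open ≡-Reasoning

∑-U : ∀ n r f → ∑ n (suc r) (U f) ≡ (r + n) * ∑ n r f
∑-U n r f = begin
  ∑ n (suc r) (U f)                    ≡⟨ ∑-cong n (suc r) (λ E → *-identityʳ (U f E)) ⟨
  ∑ n (suc r) (λ E → U f E * 1)        ≡⟨ adjoint n r f (λ _ → 1) ⟩
  ∑ n r (λ E → f E * D (λ _ → 1) E)    ≡⟨ ∑-cong-size n r (λ E e → trans (cong (f E *_) (trans (D-one E) (cong (_+ n) e))) (*-comm (f E) _)) ⟩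
  ∑ n r (λ E → (r + n) * f E)          ≡⟨ ∑-* n r (r + n) f ⟩
  (r + n) * ∑ n r f                    ∎
  where open ≡-Reasoning

#-suc : ∀ n r → suc r * # n (suc r) ≡ (r + n) * # n r
#-suc n r = trans (sym (∑-D n r (λ _ → 1)))
  (trans (∑-cong-size n r λ E e → trans (D-one E) (cong (_+ n) e))
         (trans (∑-const n r (r + n)) (*-comm (# n r) _)))

-- Norms and the spectral gap

‖_‖² : ∀ {n} → (Multiset n → ℕ) → ℕ → ℕ
‖_‖² {n} f r = ∑ n r (λ E → f E * f E)

-- Adjointness makes the left side the pairing of h with D U h, and the commutator exchanges the two
-- operators. For h = D g this brings U D g within reach of the induction hypothesis for D g.
‖U‖² : ∀ {n} r (h : Multiset n → ℕ) →
       ‖ U h ‖² (suc (suc r)) ≡ ‖ D h ‖² r + (2 * suc r + n) * ‖ h ‖² (suc r)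
‖U‖² {n} r h = begin
  ‖ U h ‖² (suc (suc r))
    ≡⟨ adjoint n (suc r) h (U h) ⟩
  ∑ n (suc r) (λ E → h E * D (U h) E)
    ≡⟨ ∑-cong-size n (suc r) (λ E e → trans
         (cong (h E *_) (trans (commutator h E) (cong (λ s → U (D h) E + (2 * s + n) * h E) e)))
         (rearrange (h E) (U (D h) E) (2 * suc r + n))) ⟩
  ∑ n (suc r) (λ E → U (D h) E * h E + (2 * suc r + n) * (h E * h E))
    ≡⟨ trans (∑-+ n (suc r) (λ E → U (D h) E * h E) _)
             (cong₂ _+_ (adjoint n r (D h) h) (∑-* n (suc r) (2 * suc r + n) _)) ⟩
  ‖ D h ‖² r + (2 * suc r + n) * ‖ h ‖² (suc r) ∎
  where
  open ≡-Reasoning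
  rearrange : ∀ x u c → x * (u + c * x) ≡ u * x + c * (x * x)
  rearrange = solve-∀

2xy≤x²+y² : ∀ x y → 2 * (x * y) ≤ x * x + y * y
2xy≤x²+y² x y with ≤-total x y
... | inj₁ x≤y with m≤n⇒∃[o]m+o≡n x≤y
...   | d , refl = ≤-trans (m≤m+n _ (d * d)) (≤-reflexive (expand x d))
  where
  expand : ∀ x d → 2 * (x * (x + d)) + d * d ≡ x * x + (x + d) * (x + d)
  expand = solve-∀
2xy≤x²+y² x y | inj₂ y≤x with m≤n⇒∃[o]m+o≡n y≤x
...   | d , refl = ≤-trans (m≤m+n _ (d * d)) (≤-reflexive (expand y d))
  where
  expand : ∀ y d → 2 * ((y + d) * y) + d * d ≡ (y + d) * (y + d) + y * y
  expand = solve-∀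

∑-zero : ∀ n f → ∑ n 0 f ≡ f (Vec.replicate n 0)
∑-zero zero    f = refl
∑-zero (suc n) f = ∑-zero n (f ∘ (0 ∷_))

-- AM-GM for U h and μ g + n ḡ, where ḡ = σ / T is the mean of g: on constants U h = (μ + n) g,
-- so this is the centred inequality, with the means moved so that no subtraction occurs.
∑-AM-GM : ∀ n r (g : Multiset n → ℕ) μ → let T = # n (suc r); σ = ∑ n (suc r) g in
  1 ≤ T →
  2 * (T * (μ * ‖ D g ‖² r)) + 2 * (n * σ * ((r + n) * (suc r * σ)))
    ≤ T * ‖ U (D g) ‖² (suc r) + (T * (μ * (μ * ‖ g ‖² (suc r))) + (2 * (μ * (n * σ)) * σ + n * σ * (n * σ)))
∑-AM-GM n r g μ T≥1 = *-cancelˡ-≤ T {{>-nonZero T≥1}} (begin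
  T * (2 * (T * (μ * B)) + 2 * (n * σ * ((r + n) * (suc r * σ))))
    ≡⟨ lhs T μ B n σ ((r + n) * (suc r * σ)) ⟩
  2 * (T * (T * μ)) * B + 2 * (T * (n * σ)) * ((r + n) * (suc r * σ))
    ≡⟨ cong₂ (λ x y → 2 * (T * (T * μ)) * x + 2 * (T * (n * σ)) * y)
         (adjoint n r (D g) g) (trans (∑-U n r (D g)) (cong ((r + n) *_) (∑-D n r g))) ⟨
  2 * (T * (T * μ)) * ∑ n (suc r) (λ E → u E * g E) + 2 * (T * (n * σ)) * ∑ n (suc r) u
    ≡⟨ trans (∑-+ n (suc r) _ _) (cong₂ _+_ (∑-* n (suc r) (2 * (T * (T * μ))) _) (∑-* n (suc r) (2 * (T * (n * σ))) u)) ⟨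
  ∑ n (suc r) (λ E → 2 * (T * (T * μ)) * (u E * g E) + 2 * (T * (n * σ)) * u E)
    ≡⟨ ∑-cong n (suc r) (λ E → xy T μ (n * σ) (u E) (g E)) ⟩
  ∑ n (suc r) (λ E → 2 * (x E * y E))
    ≤⟨ ∑-mono n (suc r) (λ E → 2xy≤x²+y² (x E) (y E)) ⟩
  ∑ n (suc r) (λ E → x E * x E + y E * y E)
    ≡⟨ ∑-cong n (suc r) (λ E → x²+y² T μ (n * σ) (u E) (g E)) ⟩
  ∑ n (suc r) (λ E → T * T * (u E * u E) + (T * μ * (T * μ) * (g E * g E) + (2 * (T * μ * (n * σ)) * g E + n * σ * (n * σ))))
    ≡⟨ trans (∑-+ n (suc r) _ _) (cong₂ _+_ (∑-* n (suc r) (T * T) _)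
         (trans (∑-+ n (suc r) _ _) (cong₂ _+_ (∑-* n (suc r) (T * μ * (T * μ)) _)
           (trans (∑-+ n (suc r) _ _) (cong₂ _+_ (∑-* n (suc r) (2 * (T * μ * (n * σ))) g) (∑-const n (suc r) (n * σ * (n * σ)))))))) ⟩
  T * T * C + (T * μ * (T * μ) * A + (2 * (T * μ * (n * σ)) * σ + T * (n * σ * (n * σ))))
    ≡⟨ rhs T μ (n * σ) A C σ ⟩
  T * (T * C + (T * (μ * (μ * A)) + (2 * (μ * (n * σ)) * σ + n * σ * (n * σ)))) ∎)
  where
  open ≤-Reasoning
  T = # n (suc r)
  σ = ∑ n (suc r) g
  A = ‖ g ‖² (suc r)
  B = ‖ D g ‖² r
  C = ‖ U (D g) ‖² (suc r)
  u x y : Multiset n → ℕ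
  u = U (D g)
  x E = T * u E
  y E = T * μ * g E + n * σ
  lhs : ∀ T μ B n σ z → T * (2 * (T * (μ * B)) + 2 * (n * σ * z)) ≡ 2 * (T * (T * μ)) * B + 2 * (T * (n * σ)) * z
  lhs = solve-∀
  xy : ∀ T μ s u g → 2 * (T * (T * μ)) * (u * g) + 2 * (T * s) * u ≡ 2 * (T * u * (T * μ * g + s))
  xy = solve-∀
  x²+y² : ∀ T μ s u g → T * u * (T * u) + (T * μ * g + s) * (T * μ * g + s) ≡
    T * T * (u * u) + (T * μ * (T * μ) * (g * g) + (2 * (T * μ * s) * g + s * s))
  x²+y² = solve-∀
  rhs : ∀ T μ s A C σ → T * T * C + (T * μ * (T * μ) * A + (2 * (T * μ * s) * σ + T * (s * s))) ≡
    T * (T * C + (T * (μ * (μ * A)) + (2 * (μ * s) * σ + s * s)))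
  rhs = solve-∀

-- The spectral gap of the up-down chain: r (r + 1 + n) is the second largest eigenvalue of U D
-- on M_n(r + 1), while the largest, attained at constants, is r (r + 1 + n) + n.
poincaré : ∀ n r (g : Multiset n → ℕ) → let T = # n (suc r); σ = ∑ n (suc r) g in
  T * ‖ D g ‖² r ≤ r * (r + suc n) * (T * ‖ g ‖² (suc r)) + n * (σ * σ)
poincaré zero    r       g = z≤n
poincaré n@(suc _) zero  g = ≤-reflexive (cong₂ _*_
  (trans (sym (*-identityˡ _)) (trans (#-suc n 0) (trans (cong (n *_) (∑-zero n (λ _ → 1))) (*-identityʳ n))))
  (trans (∑-zero n (λ E → D g E * D g E)) (cong₂ _*_ Dg≡σ Dg≡σ)))
  where
  Dg≡σ : D g (Vec.replicate n 0) ≡ ∑ n 1 g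
  Dg≡σ = trans (sym (∑-zero n (D g))) (trans (∑-D n 0 g) (*-identityˡ _))
-- Up to the terms in σ: AM-GM gives 2 μ B ≤ C + μ² A and `TC≤` gives C ≤ μ B, so μ B ≤ μ² A, and μ
-- cancels.
poincaré n@(suc n′) (suc r) g = *-cancelˡ-≤ μ (+-cancelʳ-≤ (T * (μ * B) + 2 * (n * (μ + n) * (σ * σ))) _ _ (begin
  μ * (T * B) + (T * (μ * B) + 2 * (n * (μ + n) * (σ * σ)))
    ≡⟨ left T B n σ r ⟩
  2 * (T * (μ * B)) + 2 * (n * σ * ((L + n) * (suc L * σ)))
    ≤⟨ ∑-AM-GM n L g μ (#-pos n′ (suc L)) ⟩
  T * C + (T * (μ * (μ * A)) + (2 * (μ * (n * σ)) * σ + n * σ * (n * σ)))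
    ≤⟨ +-monoˡ-≤ _ TC≤ ⟩
  μ * (T * B) + n * (μ + n) * (σ * σ) + (T * (μ * (μ * A)) + (2 * (μ * (n * σ)) * σ + n * σ * (n * σ)))
    ≡⟨ right T A B n σ μ ⟩
  μ * (μ * (T * A) + n * (σ * σ)) + (T * (μ * B) + 2 * (n * (μ + n) * (σ * σ))) ∎))
  where
  open ≤-Reasoning
  L = suc r
  μ = L * (L + suc n)
  T = # n (suc L)
  σ = ∑ n (suc L) g
  A = ‖ g ‖² (suc L)
  B = ‖ D g ‖² L
  C = ‖ U (D g) ‖² (suc L)
  left : ∀ T B n σ r → let L = suc r; μ = L * (L + suc n) in
    μ * (T * B) + (T * (μ * B) + 2 * (n * (μ + n) * (σ * σ))) ≡
    2 * (T * (μ * B)) + 2 * (n * σ * ((L + n) * (suc L * σ)))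
  left = solve-∀
  right : ∀ T A B n σ μ →
    μ * (T * B) + n * (μ + n) * (σ * σ) + (T * (μ * (μ * A)) + (2 * (μ * (n * σ)) * σ + n * σ * (n * σ))) ≡
    μ * (μ * (T * A) + n * (σ * σ)) + (T * (μ * B) + 2 * (n * (μ + n) * (σ * σ)))
  right = solve-∀
  expand : ∀ t d b r n → t * (d + (2 * suc r + n) * b) ≡ t * d + (2 * suc r + n) * (t * b)
  expand = solve-∀
  -- The commutator term 2 (r + 1) + n is exactly what raises the eigenvalue r (r + 1 + n) to (r +
  -- 1) (r + 2 + n).
  collect : ∀ tb s r n → r * (r + suc n) * tb + n * (suc (suc r) * s * (suc (suc r) * s)) + (2 * suc r + n) * tb
    ≡ suc r * (suc r + suc n) * tb + n * (suc (suc r) * s * (suc (suc r) * s))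
  collect = solve-∀
  TC≤ : T * C ≤ μ * (T * B) + n * (μ + n) * (σ * σ)
  TC≤ = *-cancelˡ-≤ (suc L) (begin
    suc L * (T * C)          ≡⟨ *-assoc (suc L) T C ⟨
    suc L * T * C            ≡⟨ cong (_* C) (#-suc n L) ⟩
    (L + n) * # n L * C      ≡⟨ *-assoc (L + n) (# n L) C ⟩
    (L + n) * (# n L * C)    ≤⟨ *-monoʳ-≤ (L + n) step ⟩
    (L + n) * (μ * (# n L * B) + n * (suc L * σ * (suc L * σ)))
      ≡⟨ distribute (# n L) B n σ r ⟩
    μ * (((L + n) * # n L) * B) + suc L * (n * (μ + n) * (σ * σ))
      ≡⟨ cong (λ z → μ * (z * B) + suc L * (n * (μ + n) * (σ * σ))) (#-suc n L) ⟨
    μ * (suc L * T * B) + suc L * (n * (μ + n) * (σ * σ))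
      ≡⟨ factor (suc L) μ T B (n * (μ + n) * (σ * σ)) ⟩
    suc L * (μ * (T * B) + n * (μ + n) * (σ * σ)) ∎)
    where
    distribute : ∀ t b n s r → let L = suc r; μ = L * (L + suc n) in
      (L + n) * (μ * (t * b) + n * (suc L * s * (suc L * s))) ≡ μ * (((L + n) * t) * b) + suc L * (n * (μ + n) * (s * s))
    distribute = solve-∀
    factor : ∀ l μ T B z → μ * (l * T * B) + l * z ≡ l * (μ * (T * B) + z)
    factor = solve-∀
    step : # n L * C ≤ μ * (# n L * B) + n * (suc L * σ * (suc L * σ))
    step = begin
      # n L * C
        ≡⟨ cong (# n L *_) (‖U‖² r (D g)) ⟩
      # n L * (‖ D (D g) ‖² r + (2 * suc r + n) * B)
        ≡⟨ expand (# n L) (‖ D (D g) ‖² r) B r n ⟩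
      # n L * ‖ D (D g) ‖² r + (2 * suc r + n) * (# n L * B)
        ≤⟨ +-monoˡ-≤ _ (poincaré n r (D g)) ⟩
      r * (r + suc n) * (# n L * B) + n * (∑ n L (D g) * ∑ n L (D g)) + (2 * suc r + n) * (# n L * B)
        ≡⟨ cong (λ z → r * (r + suc n) * (# n L * B) + n * (z * z) + (2 * suc r + n) * (# n L * B)) (∑-D n L g) ⟩
      r * (r + suc n) * (# n L * B) + n * (suc L * σ * (suc L * σ)) + (2 * suc r + n) * (# n L * B)
        ≡⟨ collect (# n L * B) σ r n ⟩
      μ * (# n L * B) + n * (suc L * σ * (suc L * σ)) ∎

-- Densities of increasing families

Monotone : ∀ {n} → (Multiset n → ℕ) → Set
Monotone f = ∀ G E → G ⊑ E → f G ≤ f E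

-- Families appear as 0-1 valued functions; in this form a squared norm is a count.
Idempotent : ∀ {n} → (Multiset n → ℕ) → Set
Idempotent f = ∀ E → f E * f E ≡ f E

-- Every extension of E has value at least f E, and the Pólya weights sum to size E + n.
D-monotone : ∀ {n} {f : Multiset n → ℕ} → Monotone f → ∀ E → (size E + n) * f E ≤ D f E
D-monotone f↑ [] = z≤n
D-monotone {suc n} {f} f↑ (k ∷ E) = begin
  (k + size E + suc n) * f (k ∷ E)               ≡⟨ rearrange k (size E) n (f (k ∷ E)) ⟩
  suc k * f (k ∷ E) + (size E + n) * f (k ∷ E)   ≤⟨ +-mono-≤
    (*-monoʳ-≤ (suc k) (f↑ (k ∷ E) (suc k ∷ E) λ { zero → n≤1+n k ; (suc i) → ≤-refl }))
    (D-monotone (λ G H G⊑H → f↑ (k ∷ G) (k ∷ H) λ { zero → ≤-refl ; (suc i) → G⊑H i }) E) ⟩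
  D f (k ∷ E) ∎
  where
  open ≤-Reasoning
  rearrange : ∀ k s n x → (k + s + suc n) * x ≡ suc k * x + (s + n) * x
  rearrange = solve-∀

∑-D-monotone : ∀ n r {f} → Monotone f → (r + n) * ∑ n r f ≤ suc r * ∑ n (suc r) f
∑-D-monotone n r {f} f↑ = begin
  (r + n) * ∑ n r f          ≡⟨ ∑-* n r (r + n) f ⟨
  ∑ n r (λ E → (r + n) * f E) ≤⟨ ∑-mono-size n r (λ E e → subst (λ s → (s + n) * f E ≤ D f E) e (D-monotone f↑ E)) ⟩
  ∑ n r (D f)                ≡⟨ ∑-D n r f ⟩
  suc r * ∑ n (suc r) f      ∎
  where open ≤-Reasoning

density-suc : ∀ n r {f} → Monotone f → ∑ n r f * # n (suc r) ≤ ∑ n (suc r) f * # n r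
density-suc n r {f} f↑ = *-cancelˡ-≤ (suc r) (begin
  suc r * (c * T)          ≡⟨ swap (suc r) c T ⟩
  c * (suc r * T)          ≡⟨ cong (c *_) (#-suc n r) ⟩
  c * ((r + n) * # n r)    ≡⟨ shift c (r + n) (# n r) ⟩
  (r + n) * c * # n r      ≤⟨ *-monoˡ-≤ (# n r) (∑-D-monotone n r f↑) ⟩
  suc r * ∑ n (suc r) f * # n r ≡⟨ *-assoc (suc r) (∑ n (suc r) f) (# n r) ⟩
  suc r * (∑ n (suc r) f * # n r) ∎)
  where
  open ≤-Reasoning
  c = ∑ n r f
  T = # n (suc r)
  swap : ∀ a b c → a * (b * c) ≡ b * (a * c)
  swap = solve-∀
  shift : ∀ a b c → a * (b * c) ≡ b * a * c
  shift = solve-∀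

-- With P_i = x_i / t_i, this composes α P_0 ≤ β P_1 and γ P_1 ≤ δ P_2; t₁ is the denominator that
-- cancels.
ratio-trans : ∀ {α β γ δ x₀ x₁ x₂ t₀ t₂} t₁ → 1 ≤ t₁ →
              α * (x₀ * t₁) ≤ β * (x₁ * t₀) → γ * (x₁ * t₂) ≤ δ * (x₂ * t₁) →
              α * γ * (x₀ * t₂) ≤ β * δ * (x₂ * t₀)
ratio-trans {α} {β} {γ} {δ} {x₀} {x₁} {x₂} {t₀} {t₂} t₁ t₁≥1 p q =
  *-cancelˡ-≤ t₁ {{>-nonZero t₁≥1}} (begin
    t₁ * (α * γ * (x₀ * t₂)) ≡⟨ e₁ t₁ α γ x₀ t₂ ⟩
    α * (x₀ * t₁) * (γ * t₂) ≤⟨ *-monoˡ-≤ (γ * t₂) p ⟩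
    β * (x₁ * t₀) * (γ * t₂) ≡⟨ e₂ β x₁ t₀ γ t₂ ⟩
    β * t₀ * (γ * (x₁ * t₂)) ≤⟨ *-monoʳ-≤ (β * t₀) q ⟩
    β * t₀ * (δ * (x₂ * t₁)) ≡⟨ e₃ β t₀ δ x₂ t₁ ⟩
    t₁ * (β * δ * (x₂ * t₀)) ∎)
  where
  open ≤-Reasoning
  e₁ : ∀ t α γ x u → t * (α * γ * (x * u)) ≡ α * (x * t) * (γ * u)
  e₁ = solve-∀
  e₂ : ∀ β x t γ u → β * (x * t) * (γ * u) ≡ β * t * (γ * (x * u))
  e₂ = solve-∀
  e₃ : ∀ β t δ x u → β * t * (δ * (x * u)) ≡ u * (β * δ * (x * t))
  e₃ = solve-∀

density-mono : ∀ n {r s f} → Monotone f → r ≤ s →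
               ∑ (suc n) r f * # (suc n) s ≤ ∑ (suc n) s f * # (suc n) r
density-mono n {r} {f = f} f↑ r≤s with m≤n⇒∃[o]m+o≡n r≤s
... | d , refl = go d
  where
  N = suc n
  go : ∀ d → ∑ N r f * # N (r + d) ≤ ∑ N (r + d) f * # N r
  go zero    rewrite +-identityʳ r = ≤-refl
  go (suc d) rewrite +-suc r d = subst₂ _≤_ (+-identityʳ _) (+-identityʳ _)
    (ratio-trans {1} {1} {1} {1} {∑ N r f} {∑ N (r + d) f} {∑ N (suc (r + d)) f} (# N (r + d)) (#-pos n (r + d))
      (+-monoˡ-≤ 0 (go d)) (+-monoˡ-≤ 0 (density-suc N (r + d) f↑)))

-- On members of level r, D f is at least r + n; its values on non-members are discarded. The gap
-- thereby limits how large level r can be in terms of level r + 1.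
poincaré-indicator : ∀ n r {f} → Monotone f → Idempotent f →
  # n (suc r) * ((r + n) * (r + n) * ∑ n r f) ≤
  r * (r + suc n) * (# n (suc r) * ∑ n (suc r) f) + n * (∑ n (suc r) f * ∑ n (suc r) f)
poincaré-indicator n r {f} f↑ f² = begin
  T * ((r + n) * (r + n) * ∑ n r f)
    ≡⟨ cong (T *_) (∑-* n r ((r + n) * (r + n)) f) ⟨
  T * ∑ n r (λ E → (r + n) * (r + n) * f E)
    ≤⟨ *-monoʳ-≤ T (∑-mono-size n r square) ⟩
  T * ‖ D f ‖² r
    ≤⟨ poincaré n r f ⟩
  r * (r + suc n) * (T * ‖ f ‖² (suc r)) + n * (c * c)
    ≡⟨ cong (λ z → r * (r + suc n) * (T * z) + n * (c * c)) (∑-cong n (suc r) f²) ⟩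
  r * (r + suc n) * (T * c) + n * (c * c) ∎
  where
  open ≤-Reasoning
  T = # n (suc r)
  c = ∑ n (suc r) f
  rearrange : ∀ m x → m * m * (x * x) ≡ m * x * (m * x)
  rearrange = solve-∀
  square : ∀ E → size E ≡ r → (r + n) * (r + n) * f E ≤ D f E * D f E
  square E refl = begin
    (r + n) * (r + n) * f E           ≡⟨ cong ((r + n) * (r + n) *_) (f² E) ⟨
    (r + n) * (r + n) * (f E * f E)   ≡⟨ rearrange (r + n) (f E) ⟩
    (r + n) * f E * ((r + n) * f E)   ≤⟨ *-mono-≤ (D-monotone f↑ E) (D-monotone f↑ E) ⟩
    D f E * D f E ∎

-- Below density 1/2 and at levels r ≤ n, the gap inequality reads P_{r+1} - P_r ≥ P_{r+1} / (4 (r + 1)).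
density-growth : ∀ n r {f} → Monotone f → Idempotent f → r ≤ suc n →
  2 * ∑ (suc n) (suc r) f ≤ # (suc n) (suc r) →
  suc (4 * suc r) * (∑ (suc n) r f * # (suc n) (suc r)) ≤ 4 * suc r * (∑ (suc n) (suc r) f * # (suc n) r)
density-growth n′ r {f} f↑ f² r≤n 2c≤T = begin
  suc (4 * L) * (c₀ * T)                  ≡⟨ split L c₀ T ⟩
  4 * (L * T) * c₀ + c₀ * T               ≤⟨ +-monoʳ-≤ _ (density-suc n r f↑) ⟩
  4 * (L * T) * c₀ + c * T₀               ≡⟨ cong (λ z → 4 * z * c₀ + c * T₀) (#-suc n r) ⟩
  4 * (m * T₀) * c₀ + c * T₀              ≡⟨ collect m T₀ c₀ c ⟩
  (4 * (m * c₀) + c) * T₀                 ≤⟨ *-monoˡ-≤ T₀ bound ⟩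
  4 * L * c * T₀                          ≡⟨ *-assoc (4 * L) c T₀ ⟩
  4 * L * (c * T₀)                        ∎
  where
  open ≤-Reasoning
  n = suc n′
  L = suc r
  m = r + n
  T = # n L
  T₀ = # n r
  c = ∑ n L f
  c₀ = ∑ n r f
  split : ∀ L c t → suc (4 * L) * (c * t) ≡ 4 * (L * t) * c + c * t
  split = solve-∀
  collect : ∀ m t c₀ c → 4 * (m * t) * c₀ + c * t ≡ (4 * (m * c₀) + c) * t
  collect = solve-∀
  e₁ : ∀ T m c₀ c → T * (m * (4 * (m * c₀) + c)) ≡ 4 * (T * (m * m * c₀)) + T * (m * c)
  e₁ = solve-∀
  e₂ : ∀ r n T c m → 4 * (r * (r + suc n) * (T * c) + n * (c * c)) + T * (m * c) ≡
    4 * (r * (r + suc n)) * (T * c) + 2 * n * c * (2 * c) + m * (T * c)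
  e₂ = solve-∀
  e₃ : ∀ r n T c → 4 * (r * (r + suc n)) * (T * c) + 2 * n * c * T + (n + n) * (T * c) ≡
    T * ((r + n) * (4 * suc r * c))
  e₃ = solve-∀
  -- The 4 is a product of two factors 2, one from Q ≥ 1/2 and one from r + n ≤ 2n.
  bound : 4 * (m * c₀) + c ≤ 4 * L * c
  bound = *-cancelˡ-≤ m {{>-nonZero (≤-trans (s≤s z≤n) (m≤n+m n r))}} (*-cancelˡ-≤ T {{>-nonZero (#-pos n′ L)}} (begin
    T * (m * (4 * (m * c₀) + c))                 ≡⟨ e₁ T m c₀ c ⟩
    4 * (T * (m * m * c₀)) + T * (m * c)         ≤⟨ +-monoˡ-≤ _ (*-monoʳ-≤ 4 (poincaré-indicator n r f↑ f²)) ⟩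
    4 * (r * (r + suc n) * (T * c) + n * (c * c)) + T * (m * c)
      ≡⟨ e₂ r n T c m ⟩
    4 * (r * (r + suc n)) * (T * c) + 2 * n * c * (2 * c) + m * (T * c)
      ≤⟨ +-mono-≤ (+-monoʳ-≤ (4 * (r * (r + suc n)) * (T * c)) (*-monoʳ-≤ (2 * n * c) 2c≤T)) (*-monoˡ-≤ (T * c) (+-monoˡ-≤ n r≤n)) ⟩
    4 * (r * (r + suc n)) * (T * c) + 2 * n * c * T + (n + n) * (T * c)
      ≡⟨ e₃ r n T c ⟩
    T * (m * (4 * L * c)) ∎))

-- The gap inequality once more, now with the factor P_{r+1} ≥ 1/2: it yields Q_r - Q_{r+1} ≥
-- Q_{r+1} / (4 (r + 1)).
codensity-decay : ∀ n r {f w₀ w} → Monotone f → Idempotent f → r ≤ suc n →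
  # (suc n) (suc r) ≤ 2 * ∑ (suc n) (suc r) f →
  ∑ (suc n) r f + w₀ ≡ # (suc n) r → ∑ (suc n) (suc r) f + w ≡ # (suc n) (suc r) →
  suc (4 * suc r) * (w * # (suc n) r) ≤ 4 * suc r * (w₀ * # (suc n) (suc r))
codensity-decay n′ r {f} {w₀} {w} f↑ f² r≤n T≤2c eq₀ eq = begin
  suc (4 * L) * (w * T₀)       ≡⟨ *-assoc (suc (4 * L)) w T₀ ⟨
  suc (4 * L) * w * T₀         ≤⟨ *-monoˡ-≤ T₀ bound ⟩
  4 * (m * w₀) * T₀            ≡⟨ shift m w₀ T₀ ⟩
  4 * (m * T₀) * w₀            ≡⟨ cong (λ z → 4 * z * w₀) (#-suc n r) ⟨
  4 * (L * T) * w₀             ≡⟨ shift′ L T w₀ ⟩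
  4 * L * (w₀ * T)             ∎
  where
  open ≤-Reasoning
  n = suc n′
  L = suc r
  m = r + n
  μ = r * (r + suc n)
  T = # n L
  T₀ = # n r
  c = ∑ n L f
  c₀ = ∑ n r f
  shift : ∀ m w t → 4 * (m * w) * t ≡ 4 * (m * t) * w
  shift = solve-∀
  shift′ : ∀ L t w → 4 * (L * t) * w ≡ 4 * L * (w * t)
  shift′ = solve-∀
  e₁ : ∀ r n c w → let T = c + w in
    n * (w * c) + (r + n) * (suc r * (T * w)) + (r * (r + suc n) * (T * c) + n * (c * c)) ≡ T * ((r + n) * (suc r * T))
  e₁ = solve-∀
  e₂ : ∀ m T c₀ w₀ → T * (m * (m * (c₀ + w₀))) ≡ T * (m * m * c₀) + T * (m * m * w₀)
  e₂ = solve-∀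
  -- `poincaré-indicator` in terms of complements: it is subtracted from T (r + n) (r + 1) T, its
  -- common value on both sides for the full family.
  gap : n * (w * c) + m * (L * (T * w)) ≤ T * (m * m * w₀)
  gap = +-cancelʳ-≤ (μ * (T * c) + n * (c * c)) _ _ (begin
    n * (w * c) + m * (L * (T * w)) + (μ * (T * c) + n * (c * c))
      ≡⟨ subst (λ t → n * (w * c) + m * (L * (t * w)) + (μ * (t * c) + n * (c * c)) ≡ t * (m * (L * t))) eq (e₁ r n c w) ⟩
    T * (m * (L * T))      ≡⟨ cong (λ z → T * (m * z)) (#-suc n r) ⟩
    T * (m * (m * T₀))     ≡⟨ cong (λ z → T * (m * (m * z))) eq₀ ⟨
    T * (m * (m * (c₀ + w₀))) ≡⟨ e₂ m T c₀ w₀ ⟩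
    T * (m * m * c₀) + T * (m * m * w₀) ≤⟨ +-monoˡ-≤ _ (poincaré-indicator n r f↑ f²) ⟩
    μ * (T * c) + n * (c * c) + T * (m * m * w₀) ≡⟨ +-comm _ (T * (m * m * w₀)) ⟩
    T * (m * m * w₀) + (μ * (T * c) + n * (c * c)) ∎)
  e₃ : ∀ T m L w → T * (m * (suc (4 * L) * w)) ≡ m * w * T + 4 * (m * (L * (T * w)))
  e₃ = solve-∀
  e₄ : ∀ n c w x → (n + n) * w * (2 * c) + 4 * x ≡ 4 * (n * (w * c) + x)
  e₄ = solve-∀
  e₅ : ∀ T m w → 4 * (T * (m * m * w)) ≡ T * (m * (4 * (m * w)))
  e₅ = solve-∀
  bound : suc (4 * L) * w ≤ 4 * (m * w₀)
  bound = *-cancelˡ-≤ m {{>-nonZero (≤-trans (s≤s z≤n) (m≤n+m n r))}} (*-cancelˡ-≤ T {{>-nonZero (#-pos n′ L)}} (begin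
    T * (m * (suc (4 * L) * w))                  ≡⟨ e₃ T m L w ⟩
    m * w * T + 4 * (m * (L * (T * w)))
      ≤⟨ +-monoˡ-≤ _ (*-mono-≤ (*-monoˡ-≤ w (+-monoˡ-≤ n r≤n)) T≤2c) ⟩
    (n + n) * w * (2 * c) + 4 * (m * (L * (T * w))) ≡⟨ e₄ n c w (m * (L * (T * w))) ⟩
    4 * (n * (w * c) + m * (L * (T * w)))        ≤⟨ *-monoʳ-≤ 4 gap ⟩
    4 * (T * (m * m * w₀))                       ≡⟨ e₅ T m w₀ ⟩
    T * (m * (4 * (m * w₀)))                     ∎))

-- Bounds and iterated contractions of ratios

idempotent⇒≤1 : ∀ x → x * x ≡ x → x ≤ 1
idempotent⇒≤1 zero    _ = z≤n
idempotent⇒≤1 (suc x) e = ≤-reflexive (*-cancelʳ-≡ (suc x) 1 (suc x) (trans e (sym (*-identityˡ _))))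

ratio-bound : ∀ {α β γ δ x y u} t → 1 ≤ t → γ * (x * t) ≤ δ * (y * u) → α * y ≤ β * t → γ * α * x ≤ δ * β * u
ratio-bound {α} {β} {γ} {δ} {x} {y} {u} t t≥1 p q = *-cancelˡ-≤ t {{>-nonZero t≥1}} (begin
  t * (γ * α * x)     ≡⟨ e₁ t γ α x ⟩
  α * (γ * (x * t))   ≤⟨ *-monoʳ-≤ α p ⟩
  α * (δ * (y * u))   ≡⟨ e₂ α δ y u ⟩
  δ * u * (α * y)     ≤⟨ *-monoʳ-≤ (δ * u) q ⟩
  δ * u * (β * t)     ≡⟨ e₃ δ u β t ⟩
  t * (δ * β * u)     ∎)
  where
  open ≤-Reasoning
  e₁ : ∀ t γ α x → t * (γ * α * x) ≡ α * (γ * (x * t))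
  e₁ = solve-∀
  e₂ : ∀ α δ y u → α * (δ * (y * u)) ≡ δ * u * (α * y)
  e₂ = solve-∀
  e₃ : ∀ δ u β t → δ * u * (β * t) ≡ t * (δ * β * u)
  e₃ = solve-∀

-- Since a / (a + 1) increases with a, the different factors at the levels between r and 2r can be
-- replaced by a common one.
weaken-contraction : ∀ {a b x y} → a ≤ b → suc a * x ≤ a * y → suc b * x ≤ b * y
weaken-contraction {a} {x = x} {y} a≤b p with m≤n⇒∃[o]m+o≡n a≤b
... | e , refl = begin
  suc (a + e) * x    ≡⟨ *-distribʳ-+ x (suc a) e ⟩
  suc a * x + e * x  ≤⟨ +-mono-≤ p (*-monoʳ-≤ e (x≤y a p)) ⟩
  a * y + e * y      ≡⟨ *-distribʳ-+ y a e ⟨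
  (a + e) * y        ∎
  where
  open ≤-Reasoning
  x≤y : ∀ a → suc a * x ≤ a * y → x ≤ y
  x≤y zero    q = ≤-trans (m≤m+n x 0) (≤-trans q z≤n)
  x≤y (suc a) q = *-cancelˡ-≤ (suc a) (≤-trans (m≤n+m _ x) q)

-- Bernoulli: (1 + 1/a)^k ≥ 1 + k/a.
bernoulli-step : ∀ a k {x y} → 1 ≤ a → (a + k) * suc a * x ≤ a * a * y → (a + suc k) * x ≤ a * y
bernoulli-step a k {x} {y} a≥1 p = *-cancelˡ-≤ a {{>-nonZero a≥1}} (begin
  a * ((a + suc k) * x)           ≤⟨ m≤m+n _ (k * x) ⟩
  a * ((a + suc k) * x) + k * x   ≡⟨ expand a k x ⟩
  (a + k) * suc a * x             ≤⟨ p ⟩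
  a * a * y                       ≡⟨ *-assoc a a y ⟩
  a * (a * y)                     ∎)
  where
  open ≤-Reasoning
  expand : ∀ a k x → a * ((a + suc k) * x) + k * x ≡ (a + k) * suc a * x
  expand = solve-∀

-- Bernoulli's linear bound a / (a + k) stands in for the k-th power of a / (a + 1). It is still a
-- constant below 1 when k is a fixed fraction of a.
growth-chain : ∀ a (x t : ℕ → ℕ) k → 1 ≤ a → (∀ i → 1 ≤ t i) →
  (∀ i → i < k → suc a * (x i * t (suc i)) ≤ a * (x (suc i) * t i)) →
  (a + k) * (x 0 * t k) ≤ a * (x k * t 0)
growth-chain a x t zero    a≥1 t≥1 step = ≤-reflexive (cong (_* (x 0 * t 0)) (+-identityʳ a))
growth-chain a x t (suc k) a≥1 t≥1 step = bernoulli-step a k a≥1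
  (ratio-trans {a + k} {a} {suc a} {a} {x 0} {x k} {x (suc k)} (t k) (t≥1 k)
    (growth-chain a x t k a≥1 t≥1 λ i i<k → step i (m<n⇒m<1+n i<k)) (step k ≤-refl))

decay-chain : ∀ a (x t : ℕ → ℕ) k → 1 ≤ a → (∀ i → 1 ≤ t i) →
  (∀ i → i < k → suc a * (x (suc i) * t i) ≤ a * (x i * t (suc i))) →
  (a + k) * (x k * t 0) ≤ a * (x 0 * t k)
decay-chain a x t zero    a≥1 t≥1 step = ≤-reflexive (cong (_* (x 0 * t 0)) (+-identityʳ a))
decay-chain a x t (suc k) a≥1 t≥1 step = bernoulli-step a k a≥1
  (subst (λ z → z * (x (suc k) * t 0) ≤ a * a * (x 0 * t (suc k))) (*-comm (suc a) (a + k))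
    (ratio-trans {suc a} {a} {a + k} {a} {x (suc k)} {x k} {x 0} (t k) (t≥1 k)
      (step k ≤-refl) (decay-chain a x t k a≥1 t≥1 λ i i<k → step i (m<n⇒m<1+n i<k))))

-- Contraction from r to 2r when 2r ≤ n

module _ (n′ : ℕ) (f : Multiset (suc n′) → ℕ) (f↑ : Monotone f) (f² : Idempotent f) where

  private
    n : ℕ
    n = suc n′

    T c w : ℕ → ℕ
    T r = # n r
    c r = ∑ n r f
    w r = T r ∸ c r

    T≥1 : ∀ r → 1 ≤ T r
    T≥1 = #-pos n′

  c≤T : ∀ r → c r ≤ T r
  c≤T r = ∑-mono n r λ E → idempotent⇒≤1 (f E) (f² E)

  c+w≡T : ∀ r → c r + w r ≡ T r
  c+w≡T r = m+[n∸m]≡n (c≤T r)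

  codensity-anti : ∀ {r s} → r ≤ s → w s * T r ≤ w r * T s
  codensity-anti {r} {s} r≤s = +-cancelˡ-≤ (c r * T s) _ _ (begin
    c r * T s + w s * T r   ≤⟨ +-monoˡ-≤ (w s * T r) (density-mono n′ f↑ r≤s) ⟩
    c s * T r + w s * T r   ≡⟨ *-distribʳ-+ (T r) (c s) (w s) ⟨
    (c s + w s) * T r       ≡⟨ cong (_* T r) (c+w≡T s) ⟩
    T s * T r               ≡⟨ *-comm (T s) (T r) ⟩
    T r * T s               ≡⟨ cong (_* T s) (c+w≡T r) ⟨
    (c r + w r) * T s       ≡⟨ *-distribʳ-+ (T s) (c r) (w r) ⟩
    c r * T s + w r * T s   ∎)
    where open ≤-Reasoning

  density-bound-below : ∀ {α β r s} → r ≤ s → α * c s ≤ β * T s → α * c r ≤ β * T r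
  density-bound-below {α} {β} {r} {s} r≤s p = subst₂ (λ a b → a * c r ≤ b * T r) (*-identityˡ α) (*-identityˡ β)
    (ratio-bound {α} {β} {1} {1} {c r} {c s} (T s) (T≥1 s) (*-monoʳ-≤ 1 (density-mono n′ f↑ r≤s)) p)

  codensity-bound-above : ∀ {α β r s} → r ≤ s → α * w r ≤ β * T r → α * w s ≤ β * T s
  codensity-bound-above {α} {β} {r} {s} r≤s p = subst₂ (λ a b → a * w s ≤ b * T s) (*-identityˡ α) (*-identityˡ β)
    (ratio-bound {α} {β} {1} {1} {w s} {w r} (T r) (T≥1 r) (*-monoʳ-≤ 1 (codensity-anti r≤s)) p)

  half-above : ∀ {r s} → r ≤ s → T r ≤ 2 * c r → T s ≤ 2 * c s
  half-above {r} {s} r≤s p = *-cancelˡ-≤ (T r) {{>-nonZero (T≥1 r)}} (begin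
    T r * T s         ≤⟨ *-monoˡ-≤ (T s) p ⟩
    2 * c r * T s     ≡⟨ *-assoc 2 (c r) (T s) ⟩
    2 * (c r * T s)   ≤⟨ *-monoʳ-≤ 2 (density-mono n′ f↑ r≤s) ⟩
    2 * (c s * T r)   ≡⟨ rearrange (c s) (T r) ⟩
    T r * (2 * c s)   ∎)
    where
    open ≤-Reasoning
    rearrange : ∀ x y → 2 * (x * y) ≡ y * (2 * x)
    rearrange = solve-∀

  private
    4L≤8r : ∀ {i} r → i < r → 4 * suc (i + r) ≤ r * 8
    4L≤8r {i} r i<r = begin
      4 * (suc i + r)  ≤⟨ *-monoʳ-≤ 4 (+-monoˡ-≤ r i<r) ⟩
      4 * (r + r)      ≡⟨ double r ⟩
      r * 8            ∎
      where
      open ≤-Reasoning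
      double : ∀ r → 4 * (r + r) ≡ r * 8
      double = solve-∀

    cancel-r : ∀ r {x y} → 1 ≤ r → (r * 8 + r) * x ≤ r * 8 * y → 9 * x ≤ 8 * y
    cancel-r r {x} {y} r≥1 p = *-cancelˡ-≤ r {{>-nonZero r≥1}} (begin
      r * (9 * x)        ≡⟨ e r x ⟩
      (r * 8 + r) * x    ≤⟨ p ⟩
      r * 8 * y          ≡⟨ *-assoc r 8 y ⟩
      r * (8 * y)        ∎)
      where
      open ≤-Reasoning
      e : ∀ r x → r * (9 * x) ≡ (r * 8 + r) * x
      e = solve-∀

    1≤8r : ∀ {r} → 1 ≤ r → 1 ≤ r * 8
    1≤8r r≥1 = ≤-trans r≥1 (m≤m*n _ 8)

    level≤n : ∀ {i} r → r + r ≤ n → i < r → i + r ≤ n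
    level≤n r 2r≤n i<r = ≤-trans (+-monoˡ-≤ r (<⇒≤ i<r)) 2r≤n

  -- Each of the r steps contracts by 8r / (8r + 1), as 4 (i + r + 1) ≤ 8r for i < r. The chain then
  -- gives 8r / (8r + r) = 8/9. Monotonicity carries density at most 1/2 from level 2r down to every
  -- level in between.
  density-doubling : ∀ r → 1 ≤ r → r + r ≤ n → 2 * c (r + r) ≤ T (r + r) →
                     9 * (c r * T (r + r)) ≤ 8 * (c (r + r) * T r)
  density-doubling r r≥1 2r≤n small = cancel-r r r≥1
    (growth-chain (r * 8) (λ i → c (i + r)) (λ i → T (i + r)) r (1≤8r r≥1) (λ i → T≥1 (i + r))
      λ i i<r → weaken-contraction (4L≤8r r i<r)
        (density-growth n′ (i + r) f↑ f² (level≤n r 2r≤n i<r)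
          (subst (2 * c (suc i + r) ≤_) (*-identityˡ _)
            (density-bound-below {2} {1} (+-monoˡ-≤ r i<r) (subst (2 * c (r + r) ≤_) (sym (*-identityˡ _)) small)))))

  codensity-doubling : ∀ r → 1 ≤ r → r + r ≤ n → T r ≤ 2 * c r →
                       9 * (w (r + r) * T r) ≤ 8 * (w r * T (r + r))
  codensity-doubling r r≥1 2r≤n large = cancel-r r r≥1
    (decay-chain (r * 8) (λ i → w (i + r)) (λ i → T (i + r)) r (1≤8r r≥1) (λ i → T≥1 (i + r))
      λ i i<r → weaken-contraction (4L≤8r r i<r)
        (codensity-decay n′ (i + r) f↑ f² (level≤n r 2r≤n i<r)
          (half-above (m≤n+m r (suc i)) large) (c+w≡T (i + r)) (c+w≡T (suc i + r))))

-- The meet of two independent uniform multisets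

meet : ∀ {n} → Multiset n → Multiset n → Multiset n
meet = zipWith _⊓_

∑² : (n a b : ℕ) → (Multiset n → ℕ) → ℕ
∑² n a b g = ∑ n a λ Y → ∑ n b λ X → g (meet Y X)

prefix : (ℕ → ℕ) → ℕ → ℕ
prefix u zero    = 0
prefix u (suc a) = prefix u a + u a

∑-prefix : ∀ n r (u : Multiset n → ℕ → ℕ) m → ∑ n r (λ E → prefix (u E) m) ≡ prefix (λ i → ∑ n r (λ E → u E i)) m
∑-prefix n r u zero    = trans (∑-const n r 0) (*-zeroʳ (# n r))
∑-prefix n r u (suc m) = trans (∑-+ n r (λ E → prefix (u E) m) (λ E → u E m)) (cong (_+ ∑ n r (λ E → u E m)) (∑-prefix n r u m))

-- The tail may have any size from 0 to a, and its size determines the first multiplicity.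
∑-tail : ∀ n a (f : Multiset n → ℕ) → ∑ (suc n) a (f ∘ tail) ≡ prefix (λ i → ∑ n i f) (suc a)
∑-tail n zero    f = refl
∑-tail n (suc a) f = trans (+-comm _ (∑ (suc n) a (f ∘ tail ∘ bump)))
  (cong (_+ ∑ n (suc a) f) (trans (∑-cong (suc n) a λ { (k ∷ E) → refl }) (∑-tail n a f)))

-- The sum of d (a - j) (b - j) * s j over j ≤ min(a, b). Here j is the size of a meet, and a - j
-- and b - j are the sizes of what is left of the two multisets.
diag : (ℕ → ℕ → ℕ) → (ℕ → ℕ) → ℕ → ℕ → ℕ
diag d s zero    b       = d 0 b * s 0
diag d s (suc a) zero    = d (suc a) 0 * s 0
diag d s (suc a) (suc b) = d (suc a) (suc b) * s 0 + diag d (s ∘ suc) a b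

diag-mono : ∀ α β d s t a b → (∀ j → α * s j ≤ β * t j) → α * diag d s a b ≤ β * diag d t a b
diag-mono α β d s t a b h = go s t h a b
  where
  open ≤-Reasoning
  swap : ∀ a b c → a * (b * c) ≡ b * (a * c)
  swap = solve-∀
  term : ∀ s t → (∀ j → α * s j ≤ β * t j) → ∀ e → α * (e * s 0) ≤ β * (e * t 0)
  term s t h e = begin
    α * (e * s 0) ≡⟨ swap α e (s 0) ⟩
    e * (α * s 0) ≤⟨ *-monoʳ-≤ e (h 0) ⟩
    e * (β * t 0) ≡⟨ swap e β (t 0) ⟩
    β * (e * t 0) ∎
  go : ∀ s t → (∀ j → α * s j ≤ β * t j) → ∀ a b → α * diag d s a b ≤ β * diag d t a b
  go s t h zero    b       = term s t h (d 0 b)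
  go s t h (suc a) zero    = term s t h (d (suc a) 0)
  go s t h (suc a) (suc b) = begin
    α * (d (suc a) (suc b) * s 0 + diag d (s ∘ suc) a b)     ≡⟨ *-distribˡ-+ α (d (suc a) (suc b) * s 0) _ ⟩
    α * (d (suc a) (suc b) * s 0) + α * diag d (s ∘ suc) a b ≤⟨ +-mono-≤ (term s t h (d (suc a) (suc b))) (go (s ∘ suc) (t ∘ suc) (h ∘ suc) a b) ⟩
    β * (d (suc a) (suc b) * t 0) + β * diag d (t ∘ suc) a b ≡⟨ *-distribˡ-+ β (d (suc a) (suc b) * t 0) _ ⟨
    β * (d (suc a) (suc b) * t 0 + diag d (t ∘ suc) a b)     ∎

diag-+ʳ : ∀ d s t a b → diag d (λ j → s j + t j) a b ≡ diag d s a b + diag d t a b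
diag-+ʳ d s t zero    b       = *-distribˡ-+ (d 0 b) (s 0) (t 0)
diag-+ʳ d s t (suc a) zero    = *-distribˡ-+ (d (suc a) 0) (s 0) (t 0)
diag-+ʳ d s t (suc a) (suc b) = trans
  (cong (d (suc a) (suc b) * (s 0 + t 0) +_) (diag-+ʳ d (s ∘ suc) (t ∘ suc) a b))
  (rearrange (d (suc a) (suc b)) (s 0) (t 0) _ _)
  where
  rearrange : ∀ e x y u v → e * (x + y) + (u + v) ≡ (e * x + u) + (e * y + v)
  rearrange = solve-∀

+-*-interchange : ∀ p q x u v → (p + q) * x + (u + v) ≡ (p * x + u) + (q * x + v)
+-*-interchange = solve-∀

diag-+ˡ : ∀ d e s a b → diag (λ i j → d i j + e i j) s a b ≡ diag d s a b + diag e s a b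
diag-+ˡ d e s zero    b       = *-distribʳ-+ (s 0) (d 0 b) (e 0 b)
diag-+ˡ d e s (suc a) zero    = *-distribʳ-+ (s 0) (d (suc a) 0) (e (suc a) 0)
diag-+ˡ d e s (suc a) (suc b) = trans
  (cong ((d (suc a) (suc b) + e (suc a) (suc b)) * s 0 +_) (diag-+ˡ d e (s ∘ suc) a b))
  (+-*-interchange (d (suc a) (suc b)) (e (suc a) (suc b)) (s 0) _ _)

diag-zero : ∀ d a b → diag d (λ _ → 0) a b ≡ 0
diag-zero d zero    b       = *-zeroʳ (d 0 b)
diag-zero d (suc a) zero    = *-zeroʳ (d (suc a) 0)
diag-zero d (suc a) (suc b) = cong₂ _+_ (*-zeroʳ (d (suc a) (suc b))) (diag-zero d a b)

rows cols : (ℕ → ℕ → ℕ) → ℕ → ℕ → ℕ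
rows e a b = prefix (λ i → e i b) a
cols e a b = prefix (e a) b

diag-rows-suc : ∀ d s a b → diag (rows d) s (suc a) b ≡ diag (rows d) s a b + diag d s a b
diag-rows-suc d s zero    zero    = refl
diag-rows-suc d s zero    (suc b) = +-identityʳ _
diag-rows-suc d s (suc a) zero    = *-distribʳ-+ (s 0) (rows d (suc a) 0) (d (suc a) 0)
diag-rows-suc d s (suc a) (suc b) = trans
  (cong (rows d (suc (suc a)) (suc b) * s 0 +_) (diag-rows-suc d (s ∘ suc) a b))
  (+-*-interchange (rows d (suc a) (suc b)) (d (suc a) (suc b)) (s 0) _ _)

rows-diag : ∀ d s a b → rows (diag d s) a b ≡ diag (rows d) s a b
rows-diag d s zero    b = refl
rows-diag d s (suc a) b = trans (cong (_+ diag d s a b) (rows-diag d s a b)) (sym (diag-rows-suc d s a b))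

diag-cols-zero : ∀ d s a → diag (cols d) s a 0 ≡ 0
diag-cols-zero d s zero    = refl
diag-cols-zero d s (suc a) = refl

diag-cols-suc : ∀ d s a b → diag (cols d) s a (suc b) ≡ diag (cols d) s a b + diag d s a b
diag-cols-suc d s zero    b       = *-distribʳ-+ (s 0) (cols d 0 b) (d 0 b)
diag-cols-suc d s (suc a) zero    = trans (cong (d (suc a) 0 * s 0 +_) (diag-cols-zero d (s ∘ suc) a)) (+-identityʳ _)
diag-cols-suc d s (suc a) (suc b) = trans
  (cong (cols d (suc a) (suc (suc b)) * s 0 +_) (diag-cols-suc d (s ∘ suc) a b))
  (+-*-interchange (cols d (suc a) (suc b)) (d (suc a) (suc b)) (s 0) _ _)

cols-diag : ∀ d s a b → cols (diag d s) a b ≡ diag (cols d) s a b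
cols-diag d s a zero    = sym (diag-cols-zero d s a)
cols-diag d s a (suc b) = trans (cong (_+ diag d s a b) (cols-diag d s a b)) (sym (diag-cols-suc d s a b))

-- A new element outside the meet lies in neither multiset, only in the first (`rows`), or only in
-- the second (`cols`).
hook : (ℕ → ℕ → ℕ) → ℕ → ℕ → ℕ
hook e a b = e a b + (rows e a b + cols e a b)

-- An exchange of finite sums: shifting both indices along the diagonal is compatible with summing
-- along a row or a column.
hook-diag : ∀ d s a b → hook (diag d s) a b ≡ diag (hook d) s a b
hook-diag d s a b = begin
  diag d s a b + (rows (diag d s) a b + cols (diag d s) a b)
    ≡⟨ cong₂ (λ x y → diag d s a b + (x + y)) (rows-diag d s a b) (cols-diag d s a b) ⟩
  diag d s a b + (diag (rows d) s a b + diag (cols d) s a b)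
    ≡⟨ cong (diag d s a b +_) (diag-+ˡ (rows d) (cols d) s a b) ⟨
  diag d s a b + diag (λ i j → rows d i j + cols d i j) s a b
    ≡⟨ diag-+ˡ d (λ i j → rows d i j + cols d i j) s a b ⟨
  diag (hook d) s a b ∎
  where open ≡-Reasoning

prefix-cong : ∀ {u v} → (∀ i → u i ≡ v i) → ∀ a → prefix u a ≡ prefix v a
prefix-cong h zero    = refl
prefix-cong h (suc a) = cong₂ _+_ (prefix-cong h a) (h a)

hook-cong : ∀ {d e} → (∀ i j → d i j ≡ e i j) → ∀ a b → hook d a b ≡ hook e a b
hook-cong h a b = cong₂ _+_ (h a b) (cong₂ _+_ (prefix-cong (λ i → h i b) a) (prefix-cong (h a) b))

meet-zeroʳ : ∀ {n} (Y : Multiset (suc n)) X → meet Y (0 ∷ X) ≡ 0 ∷ meet (tail Y) X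
meet-zeroʳ (k ∷ Y) X = cong (_∷ meet Y X) (⊓-zeroʳ k)

meet-zeroˡ : ∀ {n} (Y : Multiset n) X → meet (0 ∷ Y) X ≡ 0 ∷ meet Y (tail X)
meet-zeroˡ Y (k ∷ X) = refl

meet-bump : ∀ {n} (Y X : Multiset (suc n)) → meet (bump Y) (bump X) ≡ bump (meet Y X)
meet-bump (k ∷ Y) (l ∷ X) = refl

module _ (n : ℕ) (g : Multiset (suc n) → ℕ) where

  private
    e : ℕ → ℕ → ℕ
    e a b = ∑² n a b (g ∘ (0 ∷_))

    inner : ℕ → Multiset (suc n) → ℕ
    inner b Y = ∑ (suc n) b λ X → g (meet Y X)

  left-zero : ∀ a b → ∑ n a (λ Y → inner b (0 ∷ Y)) ≡ prefix (e a) (suc b)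
  left-zero a b = trans
    (∑-cong n a λ Y → trans
      (∑-cong (suc n) b λ X → cong g (meet-zeroˡ Y X))
      (∑-tail n b λ X → g (0 ∷ meet Y X)))
    (∑-prefix n a (λ Y i → ∑ n i λ X → g (0 ∷ meet Y X)) (suc b))

  right-zero : ∀ a b → ∑ (suc n) a (λ Y → ∑ n b λ X → g (0 ∷ meet (tail Y) X)) ≡ prefix (λ i → e i b) (suc a)
  right-zero a b = ∑-tail n a λ Y → ∑ n b λ X → g (0 ∷ meet Y X)

  ∑²-zeroˡ : ∀ b → ∑² (suc n) 0 b g ≡ hook e 0 b
  ∑²-zeroˡ b = trans (left-zero 0 b) (+-comm (prefix (e 0) b) (e 0 b))

  ∑²-zeroʳ : ∀ a → ∑² (suc n) (suc a) 0 g ≡ hook e (suc a) 0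
  ∑²-zeroʳ a = begin
    ∑ (suc n) (suc a) (λ Y → ∑ n 0 λ X → g (meet Y (0 ∷ X)))
      ≡⟨ ∑-cong (suc n) (suc a) (λ Y → ∑-cong n 0 λ X → cong g (meet-zeroʳ Y X)) ⟩
    ∑ (suc n) (suc a) (λ Y → ∑ n 0 λ X → g (0 ∷ meet (tail Y) X))
      ≡⟨ right-zero (suc a) 0 ⟩
    rows e (suc a) 0 + e (suc a) 0
      ≡⟨ +-comm (rows e (suc a) 0) (e (suc a) 0) ⟩
    e (suc a) 0 + rows e (suc a) 0
      ≡⟨ cong (e (suc a) 0 +_) (+-identityʳ (rows e (suc a) 0)) ⟨
    hook e (suc a) 0 ∎
    where open ≡-Reasoning

  -- If the first element is missing from the meet, the pair is counted by `hook`. Otherwise one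
  -- copy can be removed from both multisets, and the meet loses one copy too.
  ∑²-suc : ∀ a b → ∑² (suc n) (suc a) (suc b) g ≡ hook e (suc a) (suc b) + ∑² (suc n) a b (g ∘ bump)
  ∑²-suc a b = begin
    ∑ n (suc a) (λ Y → inner (suc b) (0 ∷ Y)) + ∑ (suc n) a (inner (suc b) ∘ bump)
      ≡⟨ cong₂ _+_ (left-zero (suc a) (suc b)) (trans
           (∑-cong (suc n) a split)
           (∑-+ (suc n) a (λ Y → ∑ n (suc b) λ X → g (0 ∷ meet (tail Y) X)) λ Y → ∑ (suc n) b λ X → g (bump (meet Y X)))) ⟩
    (cols e (suc a) (suc b) + e (suc a) (suc b)) +
      (∑ (suc n) a (λ Y → ∑ n (suc b) λ X → g (0 ∷ meet (tail Y) X)) + ∑² (suc n) a b (g ∘ bump))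
      ≡⟨ cong (λ z → (cols e (suc a) (suc b) + e (suc a) (suc b)) + (z + ∑² (suc n) a b (g ∘ bump))) (right-zero a (suc b)) ⟩
    (cols e (suc a) (suc b) + e (suc a) (suc b)) + (rows e (suc a) (suc b) + ∑² (suc n) a b (g ∘ bump))
      ≡⟨ rearrange (cols e (suc a) (suc b)) (e (suc a) (suc b)) (rows e (suc a) (suc b)) _ ⟩
    hook e (suc a) (suc b) + ∑² (suc n) a b (g ∘ bump) ∎
    where
    open ≡-Reasoning
    rearrange : ∀ x y z u → (x + y) + (z + u) ≡ (y + (z + x)) + u
    rearrange = solve-∀
    split : ∀ Y → inner (suc b) (bump Y) ≡
      ∑ n (suc b) (λ X → g (0 ∷ meet (tail Y) X)) + ∑ (suc n) b (λ X → g (bump (meet Y X)))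
    split Y@(k ∷ Y′) = cong₂ _+_
      (∑-cong n (suc b) λ X → cong g (meet-zeroʳ (bump Y) X))
      (∑-cong (suc n) b λ X → cong g (meet-bump Y X))

-- disjointPairs n a b counts the pairs of multisets of sizes a and b with disjoint supports.
disjointPairs : ℕ → ℕ → ℕ → ℕ
disjointPairs zero    zero zero = 1
disjointPairs zero    _    _    = 0
disjointPairs (suc n) a    b    = hook (disjointPairs n) a b

-- Y ∧ X = Z exactly if Y = Z + Y′ and X = Z + X′ with Y′, X′ disjoint, so the number of pairs
-- with a given meet Z depends only on the size of Z.
∑²-diag : ∀ n a b g → ∑² n a b g ≡ diag (disjointPairs n) (λ j → ∑ n j g) a b
∑²-diag zero    zero    zero    g = sym (*-identityˡ _)
∑²-diag zero    zero    (suc b) g = refl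
∑²-diag zero    (suc a) zero    g = refl
∑²-diag zero    (suc a) (suc b) g = sym (diag-zero (disjointPairs 0) a b)
∑²-diag (suc n) zero    b       g = trans (∑²-zeroˡ n g b)
  (trans (hook-cong (λ i j → ∑²-diag n i j (g ∘ (0 ∷_))) 0 b)
         (hook-diag (disjointPairs n) (λ j → ∑ n j (g ∘ (0 ∷_))) 0 b))
∑²-diag (suc n) (suc a) zero    g = trans (∑²-zeroʳ n g a)
  (trans (hook-cong (λ i j → ∑²-diag n i j (g ∘ (0 ∷_))) (suc a) 0)
         (hook-diag (disjointPairs n) (λ j → ∑ n j (g ∘ (0 ∷_))) (suc a) 0))
∑²-diag (suc n) (suc a) (suc b) g = begin
  ∑² (suc n) (suc a) (suc b) g
    ≡⟨ ∑²-suc n g a b ⟩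
  hook (λ i j → ∑² n i j g₀) (suc a) (suc b) + ∑² (suc n) a b (g ∘ bump)
    ≡⟨ cong₂ _+_
         (trans (hook-cong (λ i j → ∑²-diag n i j g₀) (suc a) (suc b))
                (hook-diag (disjointPairs n) (λ j → ∑ n j g₀) (suc a) (suc b)))
         (∑²-diag (suc n) a b (g ∘ bump)) ⟩
  (d (suc a) (suc b) * ∑ n 0 g₀ + diag d (λ j → ∑ n (suc j) g₀) a b) + diag d (λ j → ∑ (suc n) j (g ∘ bump)) a b
    ≡⟨ +-assoc (d (suc a) (suc b) * ∑ n 0 g₀) _ _ ⟩
  d (suc a) (suc b) * ∑ n 0 g₀ + (diag d (λ j → ∑ n (suc j) g₀) a b + diag d (λ j → ∑ (suc n) j (g ∘ bump)) a b)
    ≡⟨ cong (d (suc a) (suc b) * ∑ n 0 g₀ +_) (diag-+ʳ d (λ j → ∑ n (suc j) g₀) (λ j → ∑ (suc n) j (g ∘ bump)) a b) ⟨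
  diag d (λ j → ∑ (suc n) j g) (suc a) (suc b) ∎
  where
  open ≡-Reasoning
  g₀ : Multiset n → ℕ
  g₀ = g ∘ (0 ∷_)
  d : ℕ → ℕ → ℕ
  d = disjointPairs (suc n)

#-ratio : ∀ n s → (s + n) * # n s ≡ n * # (suc n) s
#-ratio n zero    = refl
#-ratio n (suc s) = begin
  (suc s + n) * # n (suc s)                 ≡⟨ *-distribʳ-+ (# n (suc s)) (suc s) n ⟩
  suc s * # n (suc s) + n * # n (suc s)     ≡⟨ cong (_+ n * # n (suc s)) (trans (#-suc n s) (#-ratio n s)) ⟩
  n * # (suc n) s + n * # n (suc s)         ≡⟨ +-comm (n * # (suc n) s) _ ⟩
  n * # n (suc s) + n * # (suc n) s         ≡⟨ *-distribˡ-+ n (# n (suc s)) _ ⟨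
  n * # (suc n) (suc s) ∎
  where open ≡-Reasoning

-- Small multiplicities are rare

low : ℕ → ℕ → ℕ
low zero    k       = 0
low (suc h) zero    = 1
low (suc h) (suc k) = low h k

low-split : ∀ h k → (low h k ≡ 1 × k < h) ⊎ (low h k ≡ 0 × h ≤ k)
low-split zero    k       = inj₂ (refl , z≤n)
low-split (suc h) zero    = inj₁ (refl , s≤s z≤n)
low-split (suc h) (suc k) with low-split h k
... | inj₁ (e , k<h) = inj₁ (e , s≤s k<h)
... | inj₂ (e , h≤k) = inj₂ (e , s≤s h≤k)

lows : ℕ → ∀ {n} → Multiset n → ℕ
lows h []      = 0
lows h (k ∷ E) = low h k + lows h E

low-head : ℕ → ∀ {n} → Multiset (suc n) → ℕ
low-head h (k ∷ E) = low h k

-- Each of the h values below h leaves a tail of size at most r, and on the nonempty ground set of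
-- the tail the level sizes do not decrease.
∑-low-head : ∀ h n r → ∑ (suc (suc n)) r (low-head h) ≤ h * # (suc n) r
∑-low-head zero    n r       = ≤-reflexive (trans
  (∑-cong (suc (suc n)) r {g = λ _ → 0} λ { (k ∷ E) → refl })
  (trans (∑-const (suc (suc n)) r 0) (*-zeroʳ (# (suc (suc n)) r))))
∑-low-head (suc h) n zero    = m≤m+n _ _
∑-low-head (suc h) n (suc r) = +-monoʳ-≤ (# (suc n) (suc r)) (begin
  ∑ (suc (suc n)) r (low-head (suc h) ∘ bump) ≡⟨ ∑-cong (suc (suc n)) r (λ { (k ∷ E) → refl }) ⟩
  ∑ (suc (suc n)) r (low-head h)              ≤⟨ ∑-low-head h n r ⟩
  h * # (suc n) r                             ≤⟨ *-monoʳ-≤ h (m≤n+m (# (suc n) r) (# n (suc r))) ⟩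
  h * # (suc n) (suc r) ∎)
  where open ≤-Reasoning

∑-singleton : ∀ r f → ∑ 1 r f ≡ f (r ∷ [])
∑-singleton zero    f = refl
∑-singleton (suc r) f = ∑-singleton r (f ∘ bump)

prefix-mono : ∀ {u v} → (∀ i → u i ≤ v i) → ∀ a → prefix u a ≤ prefix v a
prefix-mono h zero    = z≤n
prefix-mono h (suc a) = +-mono-≤ (prefix-mono h a) (h a)

prefix-* : ∀ c u a → prefix (λ i → c * u i) a ≡ c * prefix u a
prefix-* c u zero    = sym (*-zeroʳ c)
prefix-* c u (suc a) = trans (cong (_+ c * u a) (prefix-* c u a)) (sym (*-distribˡ-+ c (prefix u a) (u a)))

prefix-low≤index : ∀ h m → prefix (low h) m ≤ m
prefix-low≤index h zero    = z≤n
prefix-low≤index h (suc m) with low-split h m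
... | inj₁ (e , _) rewrite e | +-comm (prefix (low h) m) 1 = s≤s (prefix-low≤index h m)
... | inj₂ (e , _) rewrite e | +-identityʳ (prefix (low h) m) = m≤n⇒m≤1+n (prefix-low≤index h m)

prefix-low : ∀ h m → prefix (low h) m ≤ h
prefix-low h zero    = z≤n
prefix-low h (suc m) with low-split h m
... | inj₁ (e , m<h) rewrite e | +-comm (prefix (low h) m) 1 = ≤-trans (s≤s (prefix-low≤index h m)) m<h
... | inj₂ (e , _)   rewrite e | +-identityʳ (prefix (low h) m) = prefix-low h m

-- Fails for a single coordinate, whose value is forced to be r: hence at least two.
∑-lows : ∀ h n r → ∑ (suc (suc n)) r (lows h) ≤ suc (suc n) * (h * # (suc n) r)
∑-lows h n r = begin
  ∑ (suc (suc n)) r (lows h)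
    ≡⟨ trans (∑-cong (suc (suc n)) r λ { (k ∷ E) → refl }) (∑-+ (suc (suc n)) r (low-head h) (lows h ∘ tail)) ⟩
  ∑ (suc (suc n)) r (low-head h) + ∑ (suc (suc n)) r (lows h ∘ tail)
    ≤⟨ +-mono-≤ (∑-low-head h n r) (≤-trans (≤-reflexive (∑-tail (suc n) r (lows h))) (rest n)) ⟩
  h * # (suc n) r + suc n * (h * # (suc n) r) ∎
  where
  open ≤-Reasoning
  swap : ∀ a b c → a * (b * c) ≡ a * b * c
  swap = solve-∀
  rest : ∀ n → prefix (λ i → ∑ (suc n) i (lows h)) (suc r) ≤ suc n * (h * # (suc n) r)
  rest zero = begin
    prefix (λ i → ∑ 1 i (lows h)) (suc r)
      ≡⟨ prefix-cong (λ i → trans (∑-singleton i (lows h)) (+-identityʳ (low h i))) (suc r) ⟩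
    prefix (low h) (suc r)  ≤⟨ prefix-low h (suc r) ⟩
    h                       ≤⟨ m≤m*n h (# 1 r) {{>-nonZero (#-pos 0 r)}} ⟩
    h * # 1 r               ≡⟨ *-identityˡ _ ⟨
    1 * (h * # 1 r)         ∎
  rest (suc n) = begin
    prefix (λ i → ∑ (suc (suc n)) i (lows h)) (suc r)
      ≤⟨ prefix-mono (λ i → ≤-trans (∑-lows h n i) (≤-reflexive (swap (suc (suc n)) h (# (suc n) i)))) (suc r) ⟩
    prefix (λ i → suc (suc n) * h * # (suc n) i) (suc r)
      ≡⟨ prefix-* (suc (suc n) * h) (# (suc n)) (suc r) ⟩
    suc (suc n) * h * prefix (# (suc n)) (suc r)
      ≡⟨ cong (suc (suc n) * h *_) (∑-tail (suc n) r (λ _ → 1)) ⟨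
    suc (suc n) * h * # (suc (suc n)) r
      ≡⟨ swap (suc (suc n)) h _ ⟨
    suc (suc n) * (h * # (suc (suc n)) r) ∎

-- A low coordinate pays for the missing h. The bound is linear in the indicators, so expectations
-- suffice and no concentration estimate is needed.
⊓-low : ∀ h k l → h ≤ k ⊓ l + h * (low h k + low h l)
⊓-low h k l with low-split h k | low-split h l
... | inj₁ (e , _)   | _              rewrite e = ≤-trans (m≤m*n h (1 + low h l)) (m≤n+m _ (k ⊓ l))
... | inj₂ _         | inj₁ (e , _)   rewrite e | +-comm (low h k) 1 = ≤-trans (m≤m*n h (1 + low h k)) (m≤n+m _ (k ⊓ l))
... | inj₂ (_ , h≤k) | inj₂ (_ , h≤l) = ≤-trans (⊓-glb h≤k h≤l) (m≤m+n _ _)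

size-meet : ∀ h {n} (Y X : Multiset n) → n * h ≤ size (meet Y X) + h * (lows h Y + lows h X)
size-meet h []      []      = z≤n
size-meet h (k ∷ Y) (l ∷ X) = ≤-trans (+-mono-≤ (⊓-low h k l) (size-meet h Y X))
  (≤-reflexive (rearrange (k ⊓ l) h (low h k) (low h l) (size (meet Y X)) (lows h Y) (lows h X)))
  where
  rearrange : ∀ m h a b s c d → m + h * (a + b) + (s + h * (c + d)) ≡ m + s + h * (a + c + (b + d))
  rearrange = solve-∀

atLeast : ℕ → ∀ {n} → Multiset n → ℕ
atLeast r E = 1 ∸ low r (size E)

∑-atLeast : ∀ n r j → (∑ n j (atLeast r) ≡ 0 × j < r) ⊎ (∑ n j (atLeast r) ≡ # n j × r ≤ j)
∑-atLeast n r j with low-split r j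
... | inj₁ (e , j<r) = inj₁ (trans (∑-cong-size n j {g = λ _ → 0} λ { E refl → cong (1 ∸_) e }) (trans (∑-const n j 0) (*-zeroʳ (# n j))) , j<r)
... | inj₂ (e , r≤j) = inj₂ (∑-cong-size n j {g = λ _ → 1} (λ { E refl → cong (1 ∸_) e }) , r≤j)

-- A pointwise Markov inequality: a meet of size below r ≤ n h / 2 forces at least n / 2 low
-- coordinates in Y and X together.
meet-atLeast : ∀ {n} h r (Y X : Multiset n) → 1 ≤ h → r + r ≤ n * h →
               n ≤ n * atLeast r (meet Y X) + 2 * (lows h Y + lows h X)
meet-atLeast {n} h r Y X h≥1 2r≤nh with low-split r (size (meet Y X))
... | inj₂ (e , _) rewrite e = ≤-trans (≤-reflexive (sym (*-identityʳ n))) (m≤m+n _ _)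
... | inj₁ (e , s<r) rewrite e | *-zeroʳ n = *-cancelˡ-≤ h {{>-nonZero h≥1}} (+-cancelˡ-≤ (n * h) _ _ (begin
  n * h + h * n                                             ≡⟨ double n h ⟩
  2 * (n * h)                                               ≤⟨ *-monoʳ-≤ 2 (size-meet h Y X) ⟩
  2 * (size (meet Y X) + h * (lows h Y + lows h X))         ≡⟨ expand (size (meet Y X)) h (lows h Y + lows h X) ⟩
  size (meet Y X) + size (meet Y X) + h * (2 * (lows h Y + lows h X))
    ≤⟨ +-monoˡ-≤ _ (≤-trans (+-mono-≤ (<⇒≤ s<r) (<⇒≤ s<r)) 2r≤nh) ⟩
  n * h + h * (2 * (lows h Y + lows h X))                   ∎))
  where
  open ≤-Reasoning
  double : ∀ n h → n * h + h * n ≡ 2 * (n * h)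
  double = solve-∀
  expand : ∀ s h b → 2 * (s + h * b) ≡ s + s + h * (2 * b)
  expand = solve-∀

-- `meet-atLeast` summed over all pairs. The 4 is the 2 of the Markov inequality times two
-- multisets.
∑²-atLeast : ∀ n′ h r s → let n = suc (suc n′) in 1 ≤ h → r + r ≤ n * h →
             # n s * # n s ≤ ∑² n s s (atLeast r) + 4 * (h * # (suc n′) s) * # n s
∑²-atLeast n′ h r s h≥1 2r≤nh = *-cancelˡ-≤ n (begin
  n * (T * T)
    ≡⟨ trans (∑-cong n s {f = λ _ → ∑ n s λ _ → n} (λ _ → ∑-const n s n)) (trans (∑-const n s (T * n)) (rearrange T n)) ⟨
  (∑ n s λ Y → ∑ n s λ X → n)
    ≤⟨ ∑-mono n s (λ Y → ∑-mono n s λ X → meet-atLeast h r Y X h≥1 2r≤nh) ⟩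
  (∑ n s λ Y → ∑ n s λ X → n * atLeast r (meet Y X) + 2 * (lows h Y + lows h X))
    ≡⟨ ∑-cong n s (λ Y → trans (∑-+ n s _ _) (cong₂ _+_ (∑-* n s n _)
         (trans (∑-* n s 2 _) (cong (2 *_) (trans (∑-+ n s (λ _ → lows h Y) (lows h)) (cong (_+ B) (∑-const n s (lows h Y)))))))) ⟩
  (∑ n s λ Y → n * ∑ n s (λ X → atLeast r (meet Y X)) + 2 * (T * lows h Y + B))
    ≡⟨ trans (∑-+ n s _ _) (cong₂ _+_ (∑-* n s n _)
         (trans (∑-* n s 2 _) (cong (2 *_) (trans (∑-+ n s (λ Y → T * lows h Y) (λ _ → B)) (cong₂ _+_ (∑-* n s T (lows h)) (∑-const n s B)))))) ⟩
  n * M + 2 * (T * B + T * B)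
    ≤⟨ +-monoʳ-≤ (n * M) (*-monoʳ-≤ 2 (+-mono-≤ (*-monoʳ-≤ T (∑-lows h n′ s)) (*-monoʳ-≤ T (∑-lows h n′ s)))) ⟩
  n * M + 2 * (T * (n * (h * # (suc n′) s)) + T * (n * (h * # (suc n′) s)))
    ≡⟨ collect n M T (h * # (suc n′) s) ⟩
  n * (M + 4 * (h * # (suc n′) s) * T) ∎)
  where
  open ≤-Reasoning
  n = suc (suc n′)
  T = # n s
  B = ∑ n s (lows h)
  M = ∑² n s s (atLeast r)
  rearrange : ∀ T n → T * (T * n) ≡ n * (T * T)
  rearrange = solve-∀
  collect : ∀ n M T x → n * M + 2 * (T * (n * x) + T * (n * x)) ≡ n * (M + 4 * x * T)
  collect = solve-∀

meet⊑ˡ : ∀ {n} (Y X : Multiset n) → meet Y X ⊑ Y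
meet⊑ˡ (k ∷ Y) (l ∷ X) zero    = m⊓n≤m k l
meet⊑ˡ (k ∷ Y) (l ∷ X) (suc i) = meet⊑ˡ Y X i

meet⊑ʳ : ∀ {n} (Y X : Multiset n) → meet Y X ⊑ X
meet⊑ʳ (k ∷ Y) (l ∷ X) zero    = m⊓n≤n k l
meet⊑ʳ (k ∷ Y) (l ∷ X) (suc i) = meet⊑ʳ Y X i

∑²-monotone : ∀ n s f → Monotone f → Idempotent f → ∑² n s s f ≤ ∑ n s f * ∑ n s f
∑²-monotone n s f f↑ f² = begin
  ∑² n s s f
    ≤⟨ ∑-mono n s (λ Y → ∑-mono n s λ X → ≤-trans (≤-reflexive (sym (f² (meet Y X))))
         (*-mono-≤ (f↑ _ Y (meet⊑ˡ Y X)) (f↑ _ X (meet⊑ʳ Y X)))) ⟩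
  (∑ n s λ Y → ∑ n s λ X → f Y * f X) ≡⟨ ∑-cong n s (λ Y → ∑-* n s (f Y) f) ⟩
  (∑ n s λ Y → f Y * ∑ n s f)         ≡⟨ ∑-*ʳ n s (∑ n s f) f ⟩
  ∑ n s f * ∑ n s f                   ∎
  where open ≤-Reasoning

-- By `∑²-diag` the meet is uniform given its size j. For j ≥ r its density in the family is at
-- least P_r, and smaller j are dropped.
meet-density : ∀ n′ r s f → let n = suc n′ in Monotone f → Idempotent f →
  ∑ n r f * ∑² n s s (atLeast r) ≤ # n r * (∑ n s f * ∑ n s f)
meet-density n′ r s f f↑ f² = begin
  c * ∑² n s s (atLeast r)
    ≡⟨ cong (c *_) (∑²-diag n s s (atLeast r)) ⟩
  c * diag (disjointPairs n) (λ j → ∑ n j (atLeast r)) s s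
    ≤⟨ diag-mono c (# n r) (disjointPairs n) _ _ s s level ⟩
  # n r * diag (disjointPairs n) (λ j → ∑ n j f) s s
    ≡⟨ cong (# n r *_) (∑²-diag n s s f) ⟨
  # n r * ∑² n s s f
    ≤⟨ *-monoʳ-≤ (# n r) (∑²-monotone n s f f↑ f²) ⟩
  # n r * (∑ n s f * ∑ n s f) ∎
  where
  open ≤-Reasoning
  n = suc n′
  c = ∑ n r f
  level : ∀ j → c * ∑ n j (atLeast r) ≤ # n r * ∑ n j f
  level j with ∑-atLeast n r j
  ... | inj₁ (e , _)   = ≤-trans (≤-reflexive (trans (cong (c *_) e) (*-zeroʳ c))) z≤n
  ... | inj₂ (e , r≤j) = ≤-trans (≤-reflexive (cong (c *_) e)) (≤-trans (density-mono n′ f↑ r≤j) (≤-reflexive (*-comm (∑ n j f) (# n r))))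

-- K / (K + 1) is a lower bound for the probability that the meet has at least r elements.
meet-step : ∀ n′ K r s f → let n = suc (suc n′) in Monotone f → Idempotent f →
  n ≤ r + r → suc K * 16 * r ≤ s →
  K * (∑ n r f * (# n s * # n s)) ≤ suc K * (# n r * (∑ n s f * ∑ n s f))
meet-step n′ K r s f f↑ f² n≤2r s≥ = begin
  K * (c * (T * T))         ≡⟨ swap K c (T * T) ⟩
  c * (K * (T * T))         ≤⟨ *-monoʳ-≤ c KT²≤ ⟩
  c * (suc K * M)           ≡⟨ swap c (suc K) M ⟩
  suc K * (c * M)           ≤⟨ *-monoʳ-≤ (suc K) (meet-density (suc n′) r s f f↑ f²) ⟩
  suc K * (# n r * (∑ n s f * ∑ n s f)) ∎
  where
  open ≤-Reasoning
  n = suc (suc n′)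
  c = ∑ n r f
  T = # n s
  T′ = # (suc n′) s
  M = ∑² n s s (atLeast r)
  -- Large enough for 2r ≤ n h, as `meet-atLeast` requires, yet n h ≤ 4r because n ≤ 2r.
  h = suc ((r + r) / n)
  swap : ∀ a b c → a * (b * c) ≡ b * (a * c)
  swap = solve-∀
  2r≤nh : r + r ≤ n * h
  2r≤nh = begin
    r + r                                ≡⟨ m≡m%n+[m/n]*n (r + r) n ⟩
    (r + r) % n + (r + r) / n * n        ≤⟨ +-monoˡ-≤ _ (<⇒≤ (m%n<n (r + r) n)) ⟩
    h * n                                ≡⟨ *-comm h n ⟩
    n * h                                ∎
  nh≤4r : n * h ≤ 4 * r
  nh≤4r = begin
    n * h                    ≡⟨ *-comm n h ⟩
    n + (r + r) / n * n      ≤⟨ +-mono-≤ n≤2r (m/n*n≤m (r + r) n) ⟩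
    (r + r) + (r + r)        ≡⟨ quadruple r ⟩
    4 * r                    ∎
    where
    quadruple : ∀ r → (r + r) + (r + r) ≡ 4 * r
    quadruple = solve-∀
  -- T′ / T = (n - 1) / (s + n - 1) is the probability that a given element is absent from a random
  -- s-multiset. With n h ≤ 4r the 4 of `∑²-atLeast` becomes 16, hence s ≥ 16 (K + 1) r.
  few-lows : suc K * (4 * (h * T′)) ≤ T
  few-lows = *-cancelˡ-≤ n (begin
    n * (suc K * (4 * (h * T′)))     ≡⟨ e₁ n (suc K) h T′ ⟩
    suc K * 4 * (n * h) * T′         ≤⟨ *-monoˡ-≤ T′ (*-monoʳ-≤ (suc K * 4) nh≤4r) ⟩
    suc K * 4 * (4 * r) * T′         ≡⟨ cong (_* T′) (e₂ (suc K) r) ⟩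
    suc K * 16 * r * T′              ≤⟨ *-monoˡ-≤ T′ s≥ ⟩
    s * T′                           ≤⟨ *-monoˡ-≤ T′ (m≤m+n s (suc n′)) ⟩
    (s + suc n′) * T′                ≡⟨ #-ratio (suc n′) s ⟩
    suc n′ * T                       ≤⟨ *-monoˡ-≤ T (n≤1+n (suc n′)) ⟩
    n * T                            ∎)
    where
    e₁ : ∀ n k h t → n * (k * (4 * (h * t))) ≡ k * 4 * (n * h) * t
    e₁ = solve-∀
    e₂ : ∀ k r → k * 4 * (4 * r) ≡ k * 16 * r
    e₂ = solve-∀
  KT²≤ : K * (T * T) ≤ suc K * M
  KT²≤ = +-cancelˡ-≤ (T * T) _ _ (begin
    suc K * (T * T)                                ≤⟨ *-monoʳ-≤ (suc K) (∑²-atLeast n′ h r s (s≤s z≤n) 2r≤nh) ⟩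
    suc K * (M + 4 * (h * T′) * T)                 ≡⟨ e (suc K) M (4 * (h * T′)) T ⟩
    suc K * (4 * (h * T′)) * T + suc K * M         ≤⟨ +-monoˡ-≤ _ (*-monoˡ-≤ T few-lows) ⟩
    T * T + suc K * M                              ∎)
    where
    e : ∀ k m x t → k * (m + x * t) ≡ k * x * t + k * m
    e = solve-∀

-- Arithmetic of one contraction step

-- A contraction by 8/9 takes 8 / (8 + k) below 8 / (9 + k): it is exact at k = 0 and has room to
-- spare afterwards.
harmonic-step : ∀ k {x y} → 9 * (8 + k) * x ≤ 8 * 8 * y → (9 + k) * x ≤ 8 * y
harmonic-step k {x} {y} p = *-cancelˡ-≤ 8 (begin
  8 * ((9 + k) * x)            ≤⟨ m≤m+n _ (k * x) ⟩
  8 * ((9 + k) * x) + k * x    ≡⟨ expand k x ⟩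
  9 * (8 + k) * x              ≤⟨ p ⟩
  8 * 8 * y                    ≡⟨ *-assoc 8 8 y ⟩
  8 * (8 * y)                  ∎)
  where
  open ≤-Reasoning
  expand : ∀ k x → 8 * ((9 + k) * x) + k * x ≡ 9 * (8 + k) * x
  expand = solve-∀

-- With P = c / T, Q = w / T and a = 8 + k: if P² ≥ (1 - 1/a)(1 - 8/a) and P ≥ 1/2 then Q ≤ 8 / (a + 1),
-- because P² ≤ 1 - 3Q/2.
meet-+-*-interchangemetic : ∀ k c₀ w₀ c w → 1 ≤ c₀ + w₀ → 1 ≤ c + w → w ≤ c → (8 + k) * w₀ ≤ 8 * (c₀ + w₀) →
  (7 + k) * (c₀ * ((c + w) * (c + w))) ≤ (8 + k) * ((c₀ + w₀) * (c * c)) →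
  (9 + k) * w ≤ 8 * (c + w)
meet-+-*-interchangemetic k c₀ w₀ c w T₀≥1 T≥1 w≤c p q = *-cancelˡ-≤ (3 * (a * a)) (begin
  3 * (a * a) * ((9 + k) * w)          ≡⟨ e₁ k w ⟩
  (9 + k) * (3 * (a * a) * w)          ≤⟨ *-monoʳ-≤ (9 + k) 3a²w≤ ⟩
  -- The slack is 24 a² - (a + 1) (18 a - 16) = 6 a² - 2 a + 16, times T.
  (9 + k) * ((128 + 18 * k) * T)       ≤⟨ m≤m+n _ ((384 + 94 * k + 6 * (k * k)) * T) ⟩
  (9 + k) * ((128 + 18 * k) * T) + (384 + 94 * k + 6 * (k * k)) * T ≡⟨ e₂ k T ⟩
  3 * (a * a) * (8 * T)                ∎)
  where
  open ≤-Reasoning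
  a = 8 + k
  T = c + w
  T₀ = c₀ + w₀
  e₁ : ∀ k w → 3 * ((8 + k) * (8 + k)) * ((9 + k) * w) ≡ (9 + k) * (3 * ((8 + k) * (8 + k)) * w)
  e₁ = solve-∀
  e₂ : ∀ k T → (9 + k) * ((128 + 18 * k) * T) + (384 + 94 * k + 6 * (k * k)) * T ≡ 3 * ((8 + k) * (8 + k)) * (8 * T)
  e₂ = solve-∀
  e₃ : ∀ k c₀ w₀ → k * (c₀ + w₀) + 8 * (c₀ + w₀) ≡ (8 + k) * c₀ + (8 + k) * w₀
  e₃ = solve-∀
  kT₀≤ : k * T₀ ≤ a * c₀
  kT₀≤ = +-cancelʳ-≤ (8 * T₀) _ _ (begin
    k * T₀ + 8 * T₀      ≡⟨ e₃ k c₀ w₀ ⟩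
    a * c₀ + a * w₀      ≤⟨ +-monoʳ-≤ (a * c₀) p ⟩
    a * c₀ + 8 * T₀      ∎)
  e₄ : ∀ k t T → t * ((7 + k) * k * (T * T)) ≡ (7 + k) * (k * t * (T * T))
  e₄ = solve-∀
  e₅ : ∀ k c₀ T → (7 + k) * ((8 + k) * c₀ * (T * T)) ≡ (8 + k) * ((7 + k) * (c₀ * (T * T)))
  e₅ = solve-∀
  e₆ : ∀ a t c → a * (a * (t * (c * c))) ≡ t * (a * a * (c * c))
  e₆ = solve-∀
  squares : (7 + k) * k * (T * T) ≤ a * a * (c * c)
  squares = *-cancelˡ-≤ T₀ {{>-nonZero T₀≥1}} (begin
    T₀ * ((7 + k) * k * (T * T))         ≡⟨ e₄ k T₀ T ⟩
    (7 + k) * (k * T₀ * (T * T))         ≤⟨ *-monoʳ-≤ (7 + k) (*-monoˡ-≤ (T * T) kT₀≤) ⟩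
    (7 + k) * (a * c₀ * (T * T))         ≡⟨ e₅ k c₀ T ⟩
    a * ((7 + k) * (c₀ * (T * T)))       ≤⟨ *-monoʳ-≤ a q ⟩
    a * (a * (T₀ * (c * c)))             ≡⟨ e₆ a T₀ c ⟩
    T₀ * (a * a * (c * c))               ∎)
  -- 1 - P² = Q (1 + P), and w ≤ c says that P ≥ 1/2.
  2c²+3Tw≤2T² : 2 * (c * c) + 3 * (T * w) ≤ 2 * (T * T)
  2c²+3Tw≤2T² = begin
    2 * (c * c) + 3 * ((c + w) * w)                     ≡⟨ l c w ⟩
    2 * (c * c) + 3 * (c * w) + 2 * (w * w) + w * w     ≤⟨ +-monoʳ-≤ _ (*-monoˡ-≤ w w≤c) ⟩
    2 * (c * c) + 3 * (c * w) + 2 * (w * w) + c * w     ≡⟨ m c w ⟩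
    2 * ((c + w) * (c + w))                             ∎
    where
    l : ∀ c w → 2 * (c * c) + 3 * ((c + w) * w) ≡ 2 * (c * c) + 3 * (c * w) + 2 * (w * w) + w * w
    l = solve-∀
    m : ∀ c w → 2 * (c * c) + 3 * (c * w) + 2 * (w * w) + c * w ≡ 2 * ((c + w) * (c + w))
    m = solve-∀
  e₇ : ∀ k T w → T * (3 * ((8 + k) * (8 + k)) * w) + 2 * ((7 + k) * k * (T * T)) ≡
    2 * ((7 + k) * k * (T * T)) + (8 + k) * (8 + k) * (3 * (T * w))
  e₇ = solve-∀
  e₈ : ∀ a c x → 2 * (a * (c * c)) + a * x ≡ a * (2 * (c * c) + x)
  e₈ = solve-∀
  e₉ : ∀ k T → (8 + k) * (8 + k) * (2 * (T * T)) ≡ T * ((128 + 18 * k) * T) + 2 * ((7 + k) * k * (T * T))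
  e₉ = solve-∀
  -- 128 + 18 k is 18 a - 16 = 2 a² (1 - (1 - 1/a) (1 - 8/a)).
  3a²w≤ : 3 * (a * a) * w ≤ (128 + 18 * k) * T
  3a²w≤ = *-cancelˡ-≤ T {{>-nonZero T≥1}} (+-cancelʳ-≤ (2 * ((7 + k) * k * (T * T))) _ _ (begin
    T * (3 * (a * a) * w) + 2 * ((7 + k) * k * (T * T))   ≡⟨ e₇ k T w ⟩
    2 * ((7 + k) * k * (T * T)) + a * a * (3 * (T * w))   ≤⟨ +-monoˡ-≤ _ (*-monoʳ-≤ 2 squares) ⟩
    2 * (a * a * (c * c)) + a * a * (3 * (T * w))         ≡⟨ e₈ (a * a) c (3 * (T * w)) ⟩
    a * a * (2 * (c * c) + 3 * (T * w))                   ≤⟨ *-monoʳ-≤ (a * a) 2c²+3Tw≤2T² ⟩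
    a * a * (2 * (T * T))                                 ≡⟨ e₉ k T ⟩
    T * ((128 + 18 * k) * T) + 2 * ((7 + k) * k * (T * T)) ∎))

-- Thresholds

-- Stage k tolerates an error of 1 / (8 + k) only, so `meet-step` is used with K = 7 + k and the
-- level grows by a factor that depends on k.
scale : ℕ → ℕ
scale zero    = 1
scale (suc k) = (8 + k) * 16 * scale k

scale≥1 : ∀ k → 1 ≤ scale k
scale≥1 zero    = ≤-refl
scale≥1 (suc k) = *-mono-≤ {1} {(8 + k) * 16} (s≤s z≤n) (scale≥1 k)

module _ (n″ : ℕ) (f : Multiset (suc (suc n″)) → ℕ) (f↑ : Monotone f) (f² : Idempotent f) where

  private
    n′ n : ℕ
    n′ = suc n″
    n = suc n′

    T c w : ℕ → ℕ
    T r = # n r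
    c r = ∑ n r f
    w r = T r ∸ c r

    T≥1 : ∀ r → 1 ≤ T r
    T≥1 = #-pos n′

    2≤m : ∀ {m r} → 2 ≤ m → r + r ≤ m * r
    2≤m {m} {r} m≥2 = ≤-trans (≤-reflexive (cong (r +_) (sym (+-identityʳ r)))) (*-monoˡ-≤ r m≥2)

    c≤T′ : ∀ r → c r ≤ T r
    c≤T′ = c≤T n′ f f↑ f²

    c+w : ∀ r → c r + w r ≡ T r
    c+w = c+w≡T n′ f f↑ f²

  -- 64 is 16 (K + 1) for K = 3. The meet then gives 3/4 P_r ≤ P_s² ≤ P_s / 2, so P_r ≤ 2/3 P_s,
  -- which is weakened to the 8/9 of the doubling. The error is a mere factor here and does not
  -- accumulate, so 64 serves at every stage.
  density-step : ∀ r → 1 ≤ r → 2 * c (64 * r) ≤ T (64 * r) → 9 * (c r * T (64 * r)) ≤ 8 * (c (64 * r) * T r)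
  density-step r r≥1 small with ≤-total (r + r) n
  ... | inj₁ 2r≤n =
    ratio-trans {9} {8} {1} {1} {c r} {c (r + r)} {c s} {T r} {T s} (T (r + r)) (T≥1 (r + r))
      (density-doubling n′ f f↑ f² r r≥1 2r≤n
        (subst (2 * c (r + r) ≤_) (*-identityˡ _)
          (density-bound-below n′ f f↑ f² {2} {1} 2r≤s (subst (2 * c s ≤_) (sym (*-identityˡ _)) small))))
      (*-monoʳ-≤ 1 (density-mono n′ f↑ 2r≤s))
    where
    s = 64 * r
    2r≤s : r + r ≤ s
    2r≤s = 2≤m {64} {r} (s≤s (s≤s z≤n))
  ... | inj₂ n≤2r = *-cancelˡ-≤ (T s) {{>-nonZero (T≥1 s)}} (begin
    T s * (9 * (c r * T s))              ≡⟨ e₁ (T s) (c r) ⟩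
    3 * (3 * (c r * (T s * T s)))        ≤⟨ *-monoʳ-≤ 3 (meet-step n″ 3 r s f f↑ f² n≤2r ≤-refl) ⟩
    3 * (4 * (T r * (c s * c s)))        ≡⟨ e₂ (T r) (c s) ⟩
    6 * (T r * c s) * (2 * c s)          ≤⟨ *-monoʳ-≤ (6 * (T r * c s)) small ⟩
    6 * (T r * c s) * T s                ≤⟨ m≤m+n _ (2 * (T r * c s) * T s) ⟩
    6 * (T r * c s) * T s + 2 * (T r * c s) * T s ≡⟨ e₃ (T r) (c s) (T s) ⟩
    T s * (8 * (c s * T r))              ∎)
    where
    open ≤-Reasoning
    s = 64 * r
    e₁ : ∀ t x → t * (9 * (x * t)) ≡ 3 * (3 * (x * (t * t)))
    e₁ = solve-∀
    e₂ : ∀ t x → 3 * (4 * (t * (x * x))) ≡ 6 * (t * x) * (2 * x)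
    e₂ = solve-∀
    e₃ : ∀ t x u → 6 * (t * x) * u + 2 * (t * x) * u ≡ u * (8 * (x * t))
    e₃ = solve-∀

  density-small : ∀ k r → 1 ≤ r → 2 * c (64 ^ k * r) ≤ T (64 ^ k * r) → (8 + k) * c r ≤ 8 * T r
  density-small zero    r r≥1 small = *-monoʳ-≤ 8 (c≤T′ r)
  density-small (suc k) r r≥1 small = harmonic-step k {c r} {T r}
    (ratio-bound {8 + k} {8} {9} {8} {c r} {c (64 * r)} {T r} (T (64 * r)) (T≥1 (64 * r))
      (density-step r r≥1 (subst (2 * c (64 * r) ≤_) (*-identityˡ _)
        (density-bound-below n′ f f↑ f² {2} {1} (m≤n*m (64 * r) (64 ^ k) {{m^n≢0 64 k}})
          (subst (2 * c (64 ^ k * (64 * r)) ≤_) (sym (*-identityˡ _)) small′))))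
      (density-small k (64 * r) (≤-trans r≥1 (m≤n*m r 64)) small′))
    where
    rearrange : ∀ a r → 64 * a * r ≡ a * (64 * r)
    rearrange = solve-∀
    small′ : 2 * c (64 ^ k * (64 * r)) ≤ T (64 ^ k * (64 * r))
    small′ = subst (λ s → 2 * c s ≤ T s) (rearrange (64 ^ k) r) small

  codensity-step : ∀ k r → 1 ≤ r → T r ≤ 2 * c r → (8 + k) * w r ≤ 8 * T r →
                   let s = (8 + k) * 16 * r in (9 + k) * w s ≤ 8 * T s
  codensity-step k r r≥1 large p with ≤-total (r + r) n
  ... | inj₁ 2r≤n = codensity-bound-above n′ f f↑ f² {9 + k} {8} {r + r} {s} (2≤m {(8 + k) * 16} {r} (s≤s (s≤s z≤n)))
    (harmonic-step k {w (r + r)} {T (r + r)} (ratio-bound {8 + k} {8} {9} {8} {w (r + r)} {w r} {T (r + r)} (T r) (T≥1 r)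
      (codensity-doubling n′ f f↑ f² r r≥1 2r≤n large) p))
    where
    s = (8 + k) * 16 * r
  ... | inj₂ n≤2r = subst (λ t → (9 + k) * w s ≤ 8 * t) (c+w s)
    (meet-+-*-interchangemetic k (c r) (w r) (c s) (w s)
      (subst (1 ≤_) (sym (c+w r)) (T≥1 r)) (subst (1 ≤_) (sym (c+w s)) (T≥1 s)) w≤c
      (subst (λ t → (8 + k) * w r ≤ 8 * t) (sym (c+w r)) p)
      (subst₂ (λ t u → (7 + k) * (c r * (t * t)) ≤ (8 + k) * (u * (c s * c s))) (sym (c+w s)) (sym (c+w r))
        (meet-step n″ (7 + k) r s f f↑ f² n≤2r ≤-refl)))
    where
    open ≤-Reasoning
    s = (8 + k) * 16 * r
    w≤c : w s ≤ c s
    w≤c = +-cancelˡ-≤ (c s) _ _ (begin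
      c s + w s         ≡⟨ c+w s ⟩
      T s               ≤⟨ half-above n′ f f↑ f² (m≤n*m r ((8 + k) * 16)) large ⟩
      2 * c s           ≡⟨ cong (c s +_) (+-identityʳ (c s)) ⟩
      c s + c s         ∎)

  codensity-small : ∀ k r → 1 ≤ r → T r ≤ 2 * c r → (8 + k) * w (scale k * r) ≤ 8 * T (scale k * r)
  codensity-small zero    r r≥1 large = *-monoʳ-≤ 8 (m∸n≤m (T (1 * r)) (c (1 * r)))
  codensity-small (suc k) r r≥1 large = subst (λ s → (9 + k) * w s ≤ 8 * T s) (sym (*-assoc ((8 + k) * 16) (scale k) r))
    (codensity-step k (scale k * r) (*-mono-≤ (scale≥1 k) r≥1)
      (half-above n′ f f↑ f² (m≤n*m r (scale k) {{>-nonZero (scale≥1 k)}}) large)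
      (codensity-small k r r≥1 large))

-- Rounding

cancel-8 : ∀ k {x y} → (8 + 8 * k) * x ≤ 8 * y → k * x ≤ y
cancel-8 k {x} {y} p = *-cancelˡ-≤ 8 (≤-trans (m≤n+m _ (8 * x)) (≤-trans (≤-reflexive (expand k x)) p))
  where
  expand : ∀ k x → 8 * x + 8 * (k * x) ≡ (8 + 8 * k) * x
  expand = solve-∀

-- M t is an integer not above the quotient, so rounding to the nearest integer cannot fall below
-- it.
roundDiv-lower : ∀ M t p q → M * suc q ≤ suc p → M * t ≤ roundDiv (t * suc p) q
roundDiv-lower M t p q h = begin
  M * t                     ≡⟨ m*n/n≡m (M * t) den ⟨
  M * t * den / den         ≤⟨ /-monoˡ-≤ den bound ⟩
  roundDiv (t * suc p) q    ∎
  where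
  open ≤-Reasoning
  den = suc (q + suc q)
  e₁ : ∀ M t q → M * t * suc (q + suc q) ≡ 2 * (t * (M * suc q))
  e₁ = solve-∀
  bound : M * t * den ≤ 2 * (t * suc p) + suc q
  bound = begin
    M * t * den                 ≡⟨ e₁ M t q ⟩
    2 * (t * (M * suc q))       ≤⟨ *-monoʳ-≤ 2 (*-monoʳ-≤ t h) ⟩
    2 * (t * suc p)             ≤⟨ m≤m+n _ (suc q) ⟩
    2 * (t * suc p) + suc q     ∎

-- A quotient that rounds to at least 1 is at least 1/2, so rounding at most doubles it; this is the
-- 2 in the hypothesis.
roundDiv-upper : ∀ M t p q → 2 * M * suc q ≤ suc p → 1 ≤ roundDiv (t * suc q) p → M * roundDiv (t * suc q) p ≤ t
roundDiv-upper M t p q h r≥1 = *-cancelʳ-≤ (M * r) t (2 * suc q) (begin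
  M * r * (2 * suc q)         ≡⟨ e₁ M r (suc q) ⟩
  2 * M * suc q * r           ≤⟨ *-monoˡ-≤ r h ⟩
  suc p * r                   ≤⟨ +-cancelˡ-≤ (suc p * r) _ _ twice ⟩
  t * (2 * suc q)             ∎)
  where
  open ≤-Reasoning
  r = roundDiv (t * suc q) p
  e₁ : ∀ M r q → M * r * (2 * q) ≡ 2 * M * q * r
  e₁ = solve-∀
  e₂ : ∀ r p → suc p * r + suc p * r ≡ r * suc (p + suc p)
  e₂ = solve-∀
  e₃ : ∀ t p q → 2 * (t * q) + p ≡ p * 1 + t * (2 * q)
  e₃ = solve-∀
  twice : suc p * r + suc p * r ≤ suc p * r + t * (2 * suc q)
  twice = begin
    suc p * r + suc p * r             ≡⟨ e₂ r p ⟩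
    r * suc (p + suc p)               ≤⟨ m/n*n≤m (2 * (t * suc q) + suc p) (suc (p + suc p)) ⟩
    2 * (t * suc q) + suc p           ≡⟨ e₃ t (suc p) (suc q) ⟩
    suc p * 1 + t * (2 * suc q)       ≤⟨ +-monoˡ-≤ _ (*-monoʳ-≤ (suc p) r≥1) ⟩
    suc p * r + t * (2 * suc q)       ∎

-- Families as indicator functions, and the conclusion

indicator-idempotent : ∀ b → indicator b * indicator b ≡ indicator b
indicator-idempotent true  = refl
indicator-idempotent false = refl

indicator-monotone : ∀ F → Increasing F → ∀ n → Monotone (indicator ∘ F n)
indicator-monotone F F↑ n G E G⊑E with F n G in eq
... | false = z≤n
... | true  rewrite F↑ n G E G⊑E eq = ≤-refl

empty-⊑ : ∀ {n} (E : Multiset n) → Vec.replicate n 0 ⊑ E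
empty-⊑ (k ∷ E) zero    = z≤n
empty-⊑ (k ∷ E) (suc i) = empty-⊑ E i

-- If t = 0, the only multiset of level 0 belongs to the family, and then so does every multiset.
-- Such a family must be excluded: t / ω is then 0 and has probability 1.
threshold≥1 : ∀ F → Increasing F → ∀ n (E : Multiset n) → F n E ≡ false → ∀ t → HalfOrMore F n t → 1 ≤ t
threshold≥1 F F↑ n E E∉F (suc t) half = s≤s z≤n
threshold≥1 F F↑ n E E∉F zero    half with F n (Vec.replicate n 0) in eq
... | true with trans (sym (F↑ n _ E (empty-⊑ E) eq)) E∉F
...   | ()
threshold≥1 F F↑ n E E∉F zero half | false with subst₂ (λ a b → a ≤ 2 * b)
  (trans (total≡# n 0) (∑-zero n (λ _ → 1)))
  (trans (count≡∑ F n 0) (trans (∑-zero n (indicator ∘ F n)) (cong indicator eq))) half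
... | ()

-- The summand 2 provides the two coordinates that `∑-lows` and the meet argument require.
eventually : ∀ {P : ℕ → Set} N₀ N₁ → (∀ n → N₀ ≤ n → N₁ ≤ n → P (2 + n)) →
             ∀ n → 2 + (N₀ + N₁) ≤ n → P n
eventually N₀ N₁ h (suc (suc n)) (s≤s (s≤s N≤n)) = h n (≤-trans (m≤m+n N₀ N₁) N≤n) (≤-trans (m≤n+m N₁ N₀) N≤n)

theorem5 : (F : Family) → Increasing F →
    (∃ λ N → (n : ℕ) → N ≤ n → ∃ λ (E : Multiset n) → F n E ≡ false) →
    (t : ℕ → ℕ) → IsThresholdMin F t →
    (p q : ℕ → ℕ) → TendsToInfinity p q →
    ProbTo1 F (tTimesω t p q) × ProbTo0 F (tOverω t p q)
theorem5 F F↑ (N₀ , nonfull) t t-min p q ω→∞ = to1 , to0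
  where
  to1 : ProbTo1 F (tTimesω t p q)
  -- Stage 8k gives Q ≤ 8 / (8 + 8k), which is below 1 / k for positive k.
  to1 k with ω→∞ (scale (8 * k))
  ... | N₁ , ω≥ = 2 + (N₀ + N₁) , eventually N₀ N₁ bound
    where
    bound : ∀ n′ → N₀ ≤ n′ → N₁ ≤ n′ → let n = 2 + n′; s = tTimesω t p q n in
            k * (total n s ∸ count F n s) ≤ total n s
    bound n′ N₀≤ N₁≤ = subst₂ (λ a b → k * (a ∸ b) ≤ a) (sym (total≡# n s)) (sym (count≡∑ F n s))
      (cancel-8 k {# n s ∸ ∑ n s f} {# n s} (codensity-bound-above (suc n′) f f↑ f² {8 + 8 * k} {8}
        (roundDiv-lower (scale (8 * k)) (t n) (p n) (q n) (ω≥ n (m≤n⇒m≤o+n 2 N₁≤)))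
        (codensity-small n′ f f↑ f² (8 * k) (t n) t≥1
          (subst₂ (λ a b → a ≤ 2 * b) (total≡# n (t n)) (count≡∑ F n (t n)) half))))
      where
      n = 2 + n′
      s = tTimesω t p q n
      f = indicator ∘ F n
      f↑ = indicator-monotone F F↑ n
      f² : Idempotent f
      f² E = indicator-idempotent (F n E)
      half = proj₁ (t-min n (s≤s z≤n))
      E = nonfull n (m≤n⇒m≤o+n 2 N₀≤)
      t≥1 = threshold≥1 F F↑ n (proj₁ E) (proj₂ E) (t n) half

  to0 : ProbTo0 F (tOverω t p q)
  -- The 2 absorbs the rounding, and `suc` places level 64^(8k) s strictly below t, where the
  -- density is less than 1/2.
  to0 k with ω→∞ (2 * suc (64 ^ (8 * k)))
  ... | N₁ , ω≥ = 2 + (N₀ + N₁) , eventually N₀ N₁ bound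
    where
    bound : ∀ n′ → N₀ ≤ n′ → N₁ ≤ n′ → let n = 2 + n′; s = tOverω t p q n in
            k * count F n s ≤ total n s
    bound n′ N₀≤ N₁≤ = subst₂ (λ a b → k * b ≤ a) (sym (total≡# n s)) (sym (count≡∑ F n s)) (go s refl)
      where
      n = 2 + n′
      s = tOverω t p q n
      f = indicator ∘ F n
      f↑ = indicator-monotone F F↑ n
      f² : Idempotent f
      f² E = indicator-idempotent (F n E)
      half = proj₁ (t-min n (s≤s z≤n))
      E = nonfull n (m≤n⇒m≤o+n 2 N₀≤)
      t≥1 = threshold≥1 F F↑ n (proj₁ E) (proj₂ E) (t n) half
      below : ∀ {r} → r < t n → 2 * ∑ n r f < # n r
      below {r} r<t = subst₂ (λ a b → 2 * b < a) (total≡# n r) (count≡∑ F n r) (proj₂ (t-min n (s≤s z≤n)) r r<t)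
      go : ∀ r → s ≡ r → k * ∑ n r f ≤ # n r
      -- Level 0 has a single multiset and lies below t, so density less than 1/2 means density 0.
      go zero _ with ∑ n 0 f | subst (2 * ∑ n 0 f <_) (∑-zero n (λ _ → 1)) (below t≥1)
      ... | zero  | _        = ≤-trans (≤-reflexive (*-zeroʳ k)) z≤n
      ... | suc c | s≤s ()
      go (suc r) s≡ = cancel-8 k {∑ n (suc r) f} {# n (suc r)} (density-small n′ f f↑ f² (8 * k) (suc r) (s≤s z≤n)
        (<⇒≤ (below (≤-trans (+-monoˡ-≤ (64 ^ (8 * k) * suc r) (s≤s (z≤n {r})))
          (subst (λ r → suc (64 ^ (8 * k)) * r ≤ t n) s≡
            (roundDiv-upper (suc (64 ^ (8 * k))) (t n) (p n) (q n)
              (ω≥ n (m≤n⇒m≤o+n 2 N₁≤)) (subst (1 ≤_) (sym s≡) (s≤s z≤n))))))))
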